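{- Let $p$ be an odd prime and $f(x)\in\mathbb{Z}[x]$. Any periodic orbit of $f$ in $\mathbb{Z}_p$ has length at most $p^2$. If $p>3$, this length is the product of a positive integer not exceeding $p$ and a divisor of $p-1$. If $p=3$, this length is either the product of a positive integer not exceeding $3$ and a divisor of $2$, or equal to $9$; and for $p=3$ the length $9$ does occur for some $f\in\mathbb{Z}[x]$. Moreover, if $f$ is not linear, then $f$ has only finitely many periodic points in $\mathbb{Z}_p$.
   Context: $\mathbb{Z}_p$ is the ring of $p$-adic integers. A periodic orbit of $f$ in $\mathbb{Z}_p$ of length $c$ is a set $\{x,f(x),\dots,f^{c-1}(x)\}$ of $c$ distinct elements of $\mathbb{Z}_p$ with $f^c(x)=x$, where powers denote iterates; its elements are called periodic points. -}

module Defs where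

open import Data.Fin.Base using (Fin; toℕ)
open import Data.Integer.Base using (ℤ; +_; -_; _+_; _*_; _-_; 0ℤ)
open import Data.Integer.Divisibility.Signed
  using (_∣_; divides; ∣m∣n⇒∣m+n; ∣m⇒∣-m; ∣n⇒∣m*n; ∣m⇒∣m*n)
open import Data.Integer.Properties using (+-inverseʳ)
open import Data.Integer.Tactic.RingSolver using (solve-∀)
open import Data.List.Base using (List; []; _∷_; foldr)
import Data.List.Membership.Setoid as Membership
open import Data.Nat.Base as ℕ using (ℕ; zero; suc; _^_)
import Data.Nat.Divisibility as ℕ
open import Data.Nat.GeneralisedArithmetic using (iterate)
open import Data.Product.Base using (Σ-syntax; ∃-syntax; _×_)
open import Function.Definitions using (Injective)
open import Level using (0ℓ)
open import Relation.Binary.Bundles using (Setoid)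
open import Relation.Binary.PropositionalEquality using (_≡_; _≢_; refl; sym; subst)

private
  variable
    p : ℕ

infix 4 _≡_[mod_]

_≡_[mod_] : ℤ → ℤ → ℕ → Set
a ≡ b [mod m ] = + m ∣ a - b

private
  mod-refl : ∀ {m} a → a ≡ a [mod m ]
  mod-refl {m} a = subst (+ m ∣_) (sym (+-inverseʳ a)) (divides 0ℤ refl)

  mod-sym : ∀ {m} a b → a ≡ b [mod m ] → b ≡ a [mod m ]
  mod-sym {m} a b h = subst (+ m ∣_) (eq a b) (∣m⇒∣-m h)
    where
    eq : ∀ a b → - (a - b) ≡ b - a
    eq = solve-∀

  mod-trans : ∀ {m} a b c → a ≡ b [mod m ] → b ≡ c [mod m ] → a ≡ c [mod m ]
  mod-trans {m} a b c h k = subst (+ m ∣_) (eq a b c) (∣m∣n⇒∣m+n h k)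
    where
    eq : ∀ a b c → (a - b) + (b - c) ≡ a - c
    eq = solve-∀

  mod-+ : ∀ {m} a b c d → a ≡ b [mod m ] → c ≡ d [mod m ] →
          a + c ≡ b + d [mod m ]
  mod-+ {m} a b c d h k = subst (+ m ∣_) (eq a b c d) (∣m∣n⇒∣m+n h k)
    where
    eq : ∀ a b c d → (a - b) + (c - d) ≡ (a + c) - (b + d)
    eq = solve-∀

  mod-* : ∀ {m} a b c d → a ≡ b [mod m ] → c ≡ d [mod m ] →
          a * c ≡ b * d [mod m ]
  mod-* {m} a b c d h k =
    subst (+ m ∣_) (eq a b c d) (∣m∣n⇒∣m+n (∣n⇒∣m*n a k) (∣m⇒∣m*n d h))
    where
    eq : ∀ a b c d → a * (c - d) + (a - b) * d ≡ a * c - b * d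
    eq = solve-∀

-- The inverse limit of the rings ℤ/pⁿ, residue classes being given by integer
-- representatives; two elements are identified when their classes modulo pⁿ
-- agree for every n.
record ℤₚ (p : ℕ) : Set where
  field
    residue  : ℕ → ℤ
    coherent : ∀ n → residue (suc n) ≡ residue n [mod p ^ n ]

open ℤₚ public

infix 4 _≈ₚ_

-- A record so that Agda can infer x and y from a proof of x ≈ₚ y.
record _≈ₚ_ {p : ℕ} (x y : ℤₚ p) : Set where
  constructor mk≈
  field
    residue-≡ : ∀ n → residue x n ≡ residue y n [mod p ^ n ]

open _≈ₚ_ public

ℤₚ-setoid : ℕ → Setoid 0ℓ 0ℓ
ℤₚ-setoid p = record
  { Carrier       = ℤₚ p
  ; _≈_           = _≈ₚ_
  ; isEquivalence = record
    { refl  = λ {x} → mk≈ λ n → mod-refl (residue x n)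
    ; sym   = λ {x} {y} h → mk≈ λ n →
        mod-sym (residue x n) (residue y n) (residue-≡ h n)
    ; trans = λ {x} {y} {z} h k → mk≈ λ n →
        mod-trans (residue x n) (residue y n) (residue z n)
          (residue-≡ h n) (residue-≡ k n)
    }
  }

infixl 6 _+ₚ_
infixl 7 _*ₚ_

fromℤ : ℤ → ℤₚ p
fromℤ a = record { residue = λ _ → a ; coherent = λ _ → mod-refl a }

_+ₚ_ : ℤₚ p → ℤₚ p → ℤₚ p
x +ₚ y = record
  { residue  = λ n → residue x n + residue y n
  ; coherent = λ n → mod-+ (residue x (suc n)) (residue x n)
      (residue y (suc n)) (residue y n) (coherent x n) (coherent y n)
  }

_*ₚ_ : ℤₚ p → ℤₚ p → ℤₚ p
x *ₚ y = record
  { residue  = λ n → residue x n * residue y n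
  ; coherent = λ n → mod-* (residue x (suc n)) (residue x n)
      (residue y (suc n)) (residue y n) (coherent x n) (coherent y n)
  }

-- a₀ ∷ a₁ ∷ … ∷ aₙ ∷ [] is a₀ + a₁ x + … + aₙ xⁿ; trailing zeros are allowed,
-- so a polynomial has several representations.
ℤ[x] : Set
ℤ[x] = List ℤ

coeff : ℤ[x] → ℕ → ℤ
coeff []      _       = 0ℤ
coeff (a ∷ f) zero    = a
coeff (a ∷ f) (suc i) = coeff f i

-- Degree exactly one; in particular constants are not linear.
Linear : ℤ[x] → Set
Linear f = coeff f 1 ≢ 0ℤ × (∀ i → 1 ℕ.< i → coeff f i ≡ 0ℤ)

eval : ℤ[x] → ℤₚ p → ℤₚ p
eval f x = foldr (λ a acc → fromℤ a +ₚ x *ₚ acc) (fromℤ 0ℤ) f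

-- The set {x, f(x), …, fᶜ⁻¹(x)} is presented by its base point x and length c.
record PeriodicOrbit (p : ℕ) (f : ℤ[x]) : Set where
  field
    base     : ℤₚ p
    length   : ℕ
    positive : 1 ℕ.≤ length

  point : Fin length → ℤₚ p
  point i = iterate (eval f) base (toℕ i)

  field
    distinct : Injective _≡_ _≈ₚ_ point
    closed   : iterate (eval f) base length ≈ₚ base

open PeriodicOrbit public

PeriodicPoint : ∀ {p} → ℤ[x] → ℤₚ p → Set
PeriodicPoint {p} f y = Σ[ O ∈ PeriodicOrbit p f ] ∃[ i ] y ≈ₚ point O i

FinitelyMany : (ℤₚ p → Set) → Set
FinitelyMany {p} P = ∃[ xs ] (∀ y → P y → y ∈ xs)
  where open Membership (ℤₚ-setoid p) using (_∈_)

ProductOf≤And∣ : (m n c : ℕ) → Set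
ProductOf≤And∣ m n c =
  ∃[ a ] ∃[ d ] (1 ℕ.≤ a × a ℕ.≤ m × d ℕ.∣ n × c ≡ a ℕ.* d)

{-# OPTIONS --safe #-}

module Submission where

open import Defs
import Algebra.Definitions.RawSemiring as RawSemiring
import Algebra.Properties.CommutativeSemiring.Binomial as Binomial
import Algebra.Properties.Semiring.Sum as Sum
open import Algebra.Bundles using (CommutativeSemiring)
open import Data.Fin.Base as Fin using (Fin; zero; suc; toℕ; fromℕ; fromℕ<; inject₁)
import Data.Fin.Properties as Fin
open import Data.Integer.Base using (ℤ; +_; -_; _+_; _*_; _-_; 0ℤ; 1ℤ; -1ℤ; NonZero; ≢-nonZero)
  renaming (∣_∣ to abs; _^_ to _^ℤ_)
open import Data.Integer.Divisibility.Signed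
  using (divides; _∣?_; ∣-trans; ∣ᵤ⇒∣; ∣⇒∣ᵤ; ∣m∣n⇒∣m+n; ∣m⇒∣-m;
         ∣n⇒∣m*n; ∣m⇒∣m*n; *-monoˡ-∣; *-cancelʳ-∣)
  renaming (_∣_ to _∣ℤ_)
import Data.Integer.DivMod as ℤ using (_%ℕ_; _/ℕ_; a≡a%ℕn+[a/ℕn]*n; n%ℕd<d)
import Data.Integer.Properties as ℤ
open import Data.Integer.Tactic.RingSolver using (solve-∀)
open import Data.List.Base using (List; []; _∷_; foldr; tabulate; concat)
open import Data.List.Relation.Unary.Any using (Any)
open import Data.List.Relation.Unary.Any.Properties using (tabulate⁺; concat⁺)
open import Data.Nat.Base as ℕ using (ℕ; zero; suc; z≤n; s≤s; _≤_; _<_; _^_; _∸_; _!)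
open import Data.Nat.Combinatorics using (_C_; nCk≡n!/k![n-k]!; k![n∸k]!∣n!; nCn≡1)
open import Data.Nat.DivMod using (_%_; _/_; m/n*n≡m; m≡m%n+[m/n]*n; m%n<n)
open import Data.Nat.Divisibility as ℕ using (_∣_)
open import Data.Nat.GCD using (gcd; gcd[m,n]≤n; gcd[m,n]∣m; gcd-greatest; c*gcd[m,n]≡gcd[cm,cn])
open import Data.Nat.GeneralisedArithmetic using (iterate)
open import Data.Nat.Induction using (<-wellFounded)
open import Data.Nat.Primality
  using (Prime; euclidsLemma; prime⇒nonZero; prime⇒nonTrivial; ¬prime[0]; ¬prime[1])
import Data.Nat.Properties as ℕ
open import Data.Product.Base using (Σ-syntax; ∃-syntax; _×_; _,_; proj₁; proj₂)
open import Data.Sum.Base using (_⊎_; inj₁; inj₂; [_,_]′)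
open import Data.Unit.Base using (⊤; tt)
open import Function.Base using (_∘_; id; _⟨_⟩_)
open import Induction.WellFounded using (Acc; acc)
open import Relation.Binary.Bundles using (Setoid)
open import Relation.Binary.Definitions using (tri<; tri≈; tri>)
open import Relation.Binary.PropositionalEquality
  using (_≡_; _≢_; refl; sym; trans; cong; cong₂; subst; subst₂; module ≡-Reasoning)
open import Relation.Nullary.Decidable
  using (Dec; yes; no; from-yes; decidable-stable; _×-dec_; _⊎-dec_; _→-dec_)
open import Relation.Nullary.Negation using (¬_; contradiction)

-- Lengths. Let λ = h′(X) for h = fᵃ, where a ≤ p is such that h(X) ≡ X (mod p). If p ∣ λ, then
-- hⁿ(X) - X = z (1 + p w) for z = h(X) - X and all n ≥ 1, so periodicity forces z = 0. If λ ≡ 1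
-- (mod p), the exponent of p can be lifted: p ∣ h(X) - X implies v(hⁿ(X) - X) = v(n) + v(z)
-- provided p > 3 or p² ∣ z, and again z = 0. The general case is reduced to this one by passing
-- to hᵖ⁻¹ (p > 3), and to h² or h³ (p = 3). Everything happens at the level of residues, that is,
-- for integers X and congruences modulo powers of p.
--
-- Finiteness. Periodic points are roots of the nonzero polynomials fᶜ(x) - x with c ≤ p². Because
-- equality in ℤₚ is undecidable, finiteness needs a bound on how close two distinct roots of g can
-- be. If R = u g + v g′ for a nonzero integer R, then distinct roots are incongruent modulo p^|R|;
-- otherwise g and g′ have a common factor d, and every root of g is a root of g / d.
--
-- Length 9. Newton's method applied to f⁹(x) - x at 14, for f = -x⁵ - 2x³ + x - 4 and p = 3.

-- What sets `p = 3` apart is a single sum. In hᵖ(X) - X the quadratic Taylor coefficient of h is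
-- multiplied by 0² + 1² + ... + (p-1)² = p(p-1)(2p-1)/6, which p divides for p > 3, but which is 5
-- for p = 3. There the quadratic term can raise the valuation of h³(X) - X above v(z) + 1, and this
-- leaves room for one more factor 3 in the length. Once p² divides z the term is negligible for
-- every odd p, so one passage to h³ is enough. Working with residues costs precision: lifting the
-- exponent only gives p^M ∣ c (hᵏ(X) - X), where c is the length. As c is fixed while M grows, the
-- loss is bounded and disappears in the limit. That a root x of g is a root of g / d rests on
-- multiplicities: differentiation lowers the multiplicity of x in g by one, so d, which divides g′
-- up to constants, cannot absorb all of it. Multiplicity is expressed by vanishing derivatives, and
-- the argument refutes non-divisibility at each finite precision, where divisibility is decidable.

private
  variable
    k m n p : ℕ
    a b c d : ℤ
    h h₁ F F₁ G G₁ H : ℤ → ℤ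

-- Congruences and prime powers

∣-resp : a ≡ b → c ∣ℤ a → c ∣ℤ b
∣-resp refl h = h

infix 4 _≡_⟨mod_⟩

-- A record, unlike _≡_[mod_], so that Agda can infer a, b and m.
record _≡_⟨mod_⟩ (a b : ℤ) (m : ℕ) : Set where
  constructor mod
  field unmod : a ≡ b [mod m ]

open _≡_⟨mod_⟩ public

≡mod-reflexive : a ≡ b → a ≡ b ⟨mod m ⟩
≡mod-reflexive {a} refl = mod (∣-resp (sym (ℤ.+-inverseʳ a)) (divides 0ℤ refl))

≡mod-refl : a ≡ a ⟨mod m ⟩
≡mod-refl = ≡mod-reflexive refl

≡mod-sym : a ≡ b ⟨mod m ⟩ → b ≡ a ⟨mod m ⟩
≡mod-sym {a} {b} (mod h) = mod (∣-resp (eq a b) (∣m⇒∣-m h))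
  where
  eq : ∀ a b → - (a - b) ≡ b - a
  eq = solve-∀

≡mod-trans : a ≡ b ⟨mod m ⟩ → b ≡ c ⟨mod m ⟩ → a ≡ c ⟨mod m ⟩
≡mod-trans {a} {b} {c = c} (mod h) (mod k) = mod (∣-resp (eq a b c) (∣m∣n⇒∣m+n h k))
  where
  eq : ∀ a b c → (a - b) + (b - c) ≡ a - c
  eq = solve-∀

≡mod-+ : a ≡ b ⟨mod m ⟩ → c ≡ d ⟨mod m ⟩ → a + c ≡ b + d ⟨mod m ⟩
≡mod-+ {a} {b} {c = c} {d} (mod h) (mod k) = mod (∣-resp (eq a b c d) (∣m∣n⇒∣m+n h k))
  where
  eq : ∀ a b c d → (a - b) + (c - d) ≡ (a + c) - (b + d)
  eq = solve-∀

≡mod-* : a ≡ b ⟨mod m ⟩ → c ≡ d ⟨mod m ⟩ → a * c ≡ b * d ⟨mod m ⟩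
≡mod-* {a} {b} {c = c} {d} (mod h) (mod k) =
  mod (∣-resp (eq a b c d) (∣m∣n⇒∣m+n (∣n⇒∣m*n a k) (∣m⇒∣m*n d h)))
  where
  eq : ∀ a b c d → a * (c - d) + (a - b) * d ≡ a * c - b * d
  eq = solve-∀

≡mod-^ : ∀ n → a ≡ b ⟨mod m ⟩ → a ^ℤ n ≡ b ^ℤ n ⟨mod m ⟩
≡mod-^ zero    h = ≡mod-refl
≡mod-^ (suc n) h = ≡mod-* h (≡mod-^ n h)

≡mod⇒∣ : a ≡ b ⟨mod m ⟩ → + m ∣ℤ a → + m ∣ℤ b
≡mod⇒∣ {a} {b} (mod h) k = ∣-resp (eq a b) (∣m∣n⇒∣m+n k (∣m⇒∣-m h))
  where
  eq : ∀ a b → a + - (a - b) ≡ b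
  eq = solve-∀

≡mod-∣ : + m ∣ℤ + n → a ≡ b ⟨mod n ⟩ → a ≡ b ⟨mod m ⟩
≡mod-∣ h (mod k) = mod (∣-trans h k)

mod⇒+ : a ≡ b ⟨mod m ⟩ → ∃[ q ] a ≡ b + q * + m
mod⇒+ {a} {b} (mod (divides q e)) = q , trans (lem a b) (cong (_+_ b) e)
  where
  lem : ∀ a b → a ≡ b + (a - b)
  lem = solve-∀

+⇒mod : ∀ q → a ≡ b + q * + m → a ≡ b ⟨mod m ⟩
+⇒mod {a} {b} {m} q e = mod (divides q (trans (cong (_- b) e) (lem b (q * + m))))
  where
  lem : ∀ b c → b + c - b ≡ c
  lem = solve-∀

≡mod? : ∀ a b m → Dec (a ≡ b ⟨mod m ⟩)
≡mod? a b m with + m ∣? a - b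
... | yes h = yes (mod h)
... | no ¬h = no λ { (mod h) → ¬h h }

≡mod-%ℕ : ∀ a m .{{_ : ℕ.NonZero m}} → + (a ℤ.%ℕ m) ≡ a ⟨mod m ⟩
≡mod-%ℕ a m = ≡mod-sym (+⇒mod (a ℤ./ℕ m) (ℤ.a≡a%ℕn+[a/ℕn]*n a m))

%ℕ-≡mod : ∀ a b m .{{_ : ℕ.NonZero m}} → a ℤ.%ℕ m ≡ b ℤ.%ℕ m → a ≡ b ⟨mod m ⟩
%ℕ-≡mod a b m e =
  ≡mod-trans (≡mod-sym (≡mod-%ℕ a m)) (≡mod-trans (≡mod-reflexive (cong +_ e)) (≡mod-%ℕ b m))

pow-suc : ∀ p n → + (p ^ suc n) ≡ + (p ^ n) * + p
pow-suc p n = trans (cong +_ (ℕ.*-comm p (p ^ n))) (ℤ.pos-* (p ^ n) p)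

pow-mono-∣ : m ≤ n → + (p ^ m) ∣ℤ + (p ^ n)
pow-mono-∣ {m} {n} {p} m≤n = ∣ᵤ⇒∣ (ℕ.divides (p ^ (n ℕ.∸ m))
  (trans (cong (p ^_) (sym (ℕ.m∸n+n≡m m≤n))) (ℕ.^-distribˡ-+-* p (n ℕ.∸ m) m)))

p∣pow : + p ∣ℤ + (p ^ suc n)
p∣pow {p} {n} = divides (+ (p ^ n)) (pow-suc p n)

prime⇒1< : Prime p → 1 < p
prime⇒1< {p} pr = ℕ.nonTrivial⇒n>1 p {{prime⇒nonTrivial pr}}

nonZeroℤ : Prime p → NonZero (+ p)
nonZeroℤ pr = prime⇒nonZero pr

euclidℤ : Prime p → ∀ a b → + p ∣ℤ a * b → + p ∣ℤ a ⊎ + p ∣ℤ b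
euclidℤ pr a b h
  with euclidsLemma (abs a) (abs b) pr (subst (_ ∣_) (ℤ.abs-* a b) (∣⇒∣ᵤ h))
... | inj₁ k = inj₁ (∣ᵤ⇒∣ k)
... | inj₂ k = inj₂ (∣ᵤ⇒∣ k)

pow-∣-cancelʳ : Prime p → ∀ n a b → ¬ + p ∣ℤ b → + (p ^ n) ∣ℤ a * b → + (p ^ n) ∣ℤ a
pow-∣-cancelʳ pr zero    a b _  _ = divides a (sym (ℤ.*-identityʳ a))
pow-∣-cancelʳ {p} pr (suc n) a b p∤b h
  with euclidℤ pr a b (∣-trans (p∣pow {n = n}) h)
... | inj₂ p∣b = contradiction p∣b p∤b
... | inj₁ (divides q refl) = subst (_∣ℤ q * + p) (sym (pow-suc p n))
        (*-monoˡ-∣ (+ p) (pow-∣-cancelʳ pr n q b p∤b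
          (*-cancelʳ-∣ (+ p) {{nonZeroℤ pr}} (subst₂ _∣ℤ_ (pow-suc p n) (eq q (+ p) b) h))))
  where
  eq : ∀ q p b → q * p * b ≡ q * b * p
  eq = solve-∀

-- The last hypothesis says v(b) < s, so removing the factors `p` from `b` one at a time leaves at
-- least `p ^ n` for `a`.
pow-∣-split : Prime p → ∀ s n a b → + (p ^ (n ℕ.+ s)) ∣ℤ a * b → ¬ + (p ^ s) ∣ℤ b → + (p ^ n) ∣ℤ a
pow-∣-split pr zero    n a b h k = contradiction (divides b (sym (ℤ.*-identityʳ b))) k
pow-∣-split {p} pr (suc s) n a b h k with + p ∣? b
... | no p∤b = pow-∣-cancelʳ pr n a b p∤b (∣-trans (pow-mono-∣ (ℕ.m≤m+n n (suc s))) h)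
... | yes (divides q refl) = pow-∣-split pr s n a q
  (*-cancelʳ-∣ (+ p) {{nonZeroℤ pr}}
    (subst₂ _∣ℤ_ (trans (cong (λ e → + (p ^ e)) (ℕ.+-suc n s)) (pow-suc p (n ℕ.+ s)))
      (sym (ℤ.*-assoc a q (+ p))) h))
  λ l → k (subst (_∣ℤ q * + p) (sym (pow-suc p s)) (*-monoˡ-∣ (+ p) l))

-- Taylor expansions of polynomial functions

evalℤ : ℤ[x] → ℤ → ℤ
evalℤ f x = foldr (λ a acc → a + x * acc) 0ℤ f

iterate-suc : ∀ {A : Set} (f : A → A) x n → iterate f x (suc n) ≡ f (iterate f x n)
iterate-suc f x zero    = refl
iterate-suc f x (suc n) = iterate-suc f (f x) n

iterate-+ : ∀ {A : Set} (f : A → A) x m n → iterate f x (m ℕ.+ n) ≡ iterate f (iterate f x m) n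
iterate-+ f x zero    n = refl
iterate-+ f x (suc m) n = iterate-+ f (f x) m n

iterate-* : ∀ {A : Set} (f : A → A) x m n →
            iterate f x (m ℕ.* n) ≡ iterate (λ y → iterate f y n) x m
iterate-* f x zero    n = refl
iterate-* f x (suc m) n =
  trans (iterate-+ f x n (m ℕ.* n)) (iterate-* f (iterate f x n) m n)

-- Differentiability is a Taylor expansion with an integral remainder. It determines `F₁`
-- (`derivative-unique`) and makes both `F` and `F₁` respect congruences.
record Derivative (F F₁ : ℤ → ℤ) : Set where
  constructor mkDerivative
  field expand : ∀ X u → ∃[ r ] F (X + u) ≡ F X + F₁ X * u + r * (u * u)

open Derivative public

-- `D²` is half the second derivative, which keeps the coefficients integral. It is singled out
-- because the quadratic term is where `p = 3` and `p > 3` part ways.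
record Smooth (F : ℤ → ℤ) : Set where
  field
    D¹ D²  : ℤ → ℤ
    taylor : ∀ X u → ∃[ r ] F (X + u) ≡ F X + D¹ X * u + D² X * (u * u) + r * (u * u * u)

  derivative : Derivative F D¹
  derivative .expand X u with r , eq ← taylor X u =
    D² X + r * u , trans eq (lem (F X) (D¹ X) (D² X) r u)
    where
    lem : ∀ a b c r u →
          a + b * u + c * (u * u) + r * (u * u * u) ≡ a + b * u + (c + r * u) * (u * u)
    lem = solve-∀

open Smooth public

smooth-const : ∀ a → Smooth (λ _ → a)
smooth-const a .D¹ _ = 0ℤ
smooth-const a .D² _ = 0ℤ
smooth-const a .taylor X u = 0ℤ , lem a u
  where
  lem : ∀ a u → a ≡ a + 0ℤ * u + 0ℤ * (u * u) + 0ℤ * (u * u * u)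
  lem = solve-∀

smooth-id : Smooth (λ X → X)
smooth-id .D¹ _ = 1ℤ
smooth-id .D² _ = 0ℤ
smooth-id .taylor X u = 0ℤ , lem X u
  where
  lem : ∀ X u → X + u ≡ X + 1ℤ * u + 0ℤ * (u * u) + 0ℤ * (u * u * u)
  lem = solve-∀

smooth-+ : Smooth F → Smooth G → Smooth (λ X → F X + G X)
smooth-+ S T .D¹ X = S .D¹ X + T .D¹ X
smooth-+ S T .D² X = S .D² X + T .D² X
smooth-+ {F} {G} S T .taylor X u with r , e ← S .taylor X u | s , e′ ← T .taylor X u =
  r + s , trans (cong₂ _+_ e e′) (lem (F X) (S .D¹ X) (S .D² X) r (G X) (T .D¹ X) (T .D² X) s u)
  where
  lem : ∀ a b c r a′ b′ c′ s u →
        (a + b * u + c * (u * u) + r * (u * u * u)) + (a′ + b′ * u + c′ * (u * u) + s * (u * u * u))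
        ≡ (a + a′) + (b + b′) * u + (c + c′) * (u * u) + (r + s) * (u * u * u)
  lem = solve-∀

smooth-* : Smooth F → Smooth G → Smooth (λ X → F X * G X)
smooth-* {F} {G} S T .D¹ X = F X * T .D¹ X + S .D¹ X * G X
smooth-* {F} {G} S T .D² X = F X * T .D² X + S .D¹ X * T .D¹ X + S .D² X * G X
smooth-* {F} {G} S T .taylor X u with r , e ← S .taylor X u | s , e′ ← T .taylor X u =
  F X * s + S .D¹ X * T .D² X + S .D² X * T .D¹ X + r * G X
    + u * (S .D¹ X * s + S .D² X * T .D² X + r * T .D¹ X
      + u * (S .D² X * s + r * T .D² X + u * (r * s))) ,
  trans (cong₂ _*_ e e′) (lem (F X) (S .D¹ X) (S .D² X) r (G X) (T .D¹ X) (T .D² X) s u)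
  where
  lem : ∀ a b c r a′ b′ c′ s u →
        (a + b * u + c * (u * u) + r * (u * u * u)) * (a′ + b′ * u + c′ * (u * u) + s * (u * u * u))
        ≡ a * a′ + (a * b′ + b * a′) * u + (a * c′ + b * b′ + c * a′) * (u * u)
          + (a * s + b * c′ + c * b′ + r * a′
            + u * (b * s + c * c′ + r * b′ + u * (c * s + r * c′ + u * (r * s)))) * (u * u * u)
  lem = solve-∀

smooth-∘ : Smooth G → Smooth F → Smooth (λ X → G (F X))
smooth-∘ {G} {F} T S .D¹ X = T .D¹ (F X) * S .D¹ X
smooth-∘ {G} {F} T S .D² X = T .D¹ (F X) * S .D² X + T .D² (F X) * (S .D¹ X * S .D¹ X)
smooth-∘ {G} {F} T S .taylor X u with r , e ← S .taylor X u
  with s , e′ ← T .taylor (F X) (S .D¹ X * u + S .D² X * (u * u) + r * (u * u * u)) =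
  T .D¹ (F X) * r
    + T .D² (F X) * (S .D¹ X * S .D² X + S .D¹ X * S .D² X
      + (S .D¹ X * r + S .D¹ X * r + S .D² X * S .D² X) * u
      + (S .D² X * r + S .D² X * r) * (u * u) + r * r * (u * u * u))
    + s * ((S .D¹ X + S .D² X * u + r * (u * u)) * (S .D¹ X + S .D² X * u + r * (u * u))
      * (S .D¹ X + S .D² X * u + r * (u * u))) ,
  trans (cong G (trans e (assoc (F X) (S .D¹ X) (S .D² X) r u)))
        (trans e′ (lem (G (F X)) (T .D¹ (F X)) (T .D² (F X)) s (S .D¹ X) (S .D² X) r u))
  where
  assoc : ∀ a b c r u →
          a + b * u + c * (u * u) + r * (u * u * u) ≡ a + (b * u + c * (u * u) + r * (u * u * u))
  assoc = solve-∀
  lem : ∀ a a₁ a₂ s b c r u →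
        let v = b * u + c * (u * u) + r * (u * u * u)
            w = b + c * u + r * (u * u) in
        a + a₁ * v + a₂ * (v * v) + s * (v * v * v)
        ≡ a + (a₁ * b) * u + (a₁ * c + a₂ * (b * b)) * (u * u)
          + (a₁ * r + a₂ * (b * c + b * c + (b * r + b * r + c * c) * u + (c * r + c * r) * (u * u)
            + r * r * (u * u * u)) + s * (w * w * w)) * (u * u * u)
  lem = solve-∀

smooth-evalℤ : ∀ f → Smooth (evalℤ f)
smooth-evalℤ []      = smooth-const 0ℤ
smooth-evalℤ (a ∷ f) = smooth-+ (smooth-const a) (smooth-* smooth-id (smooth-evalℤ f))

smooth-iterate : Smooth F → ∀ n → Smooth (λ X → iterate F X n)
smooth-iterate S zero    = smooth-id
smooth-iterate S (suc n) = smooth-∘ (smooth-iterate S n) S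

-- Expanding from `X` to `X + u` and then back by `- u` gives F₁(X + u) u = (F₁(X) + (r + s) u) u;
-- cancel `u`.
derivative-Lipschitz : Derivative F F₁ → ∀ X u → ∃[ s ] F₁ (X + u) ≡ F₁ X + s * u
derivative-Lipschitz {F} {F₁} D X u with u ℤ.≟ 0ℤ
... | yes refl = 0ℤ , trans (cong F₁ (ℤ.+-identityʳ X)) (sym (ℤ.+-identityʳ (F₁ X)))
... | no u≢0 with r , e ← expand D X u | s , e′ ← expand D (X + u) (- u) = r + s ,
  ℤ.*-cancelʳ-≡ _ _ u {{≢-nonZero u≢0}}
    (trans (lem₁ (F X) (F₁ X) (F₁ (X + u)) r s u)
      (trans (cong (λ y → F X + (F₁ X + (r + s) * u) * u - y) eq)
        (lem₃ (F X) ((F₁ X + (r + s) * u) * u))))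
  where
  lem₁ : ∀ a b b′ r s u → b′ * u
         ≡ a + (b + (r + s) * u) * u - (a + b * u + r * (u * u) + b′ * - u + s * (- u * - u))
  lem₁ = solve-∀
  lem₃ : ∀ a b → a + b - a ≡ b
  lem₃ = solve-∀
  eq : F X + F₁ X * u + r * (u * u) + F₁ (X + u) * - u + s * (- u * - u) ≡ F X
  eq = trans (cong (λ y → y + F₁ (X + u) * - u + s * (- u * - u)) (sym e))
         (trans (sym e′) (cong F (lem₂ X u)))
    where
    lem₂ : ∀ X u → X + u + - u ≡ X
    lem₂ = solve-∀

derivative-≡mod : Derivative F F₁ → a ≡ b ⟨mod m ⟩ → F a ≡ F b ⟨mod m ⟩
derivative-≡mod {F} {F₁} {b = b} {m} D h with q , refl ← mod⇒+ h with r , e ← expand D b (q * + m) =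
  +⇒mod (F₁ b * q + r * q * (q * + m)) (trans e (lem (F b) (F₁ b) q (+ m) r))
  where
  lem : ∀ a b q m r → a + b * (q * m) + r * ((q * m) * (q * m)) ≡ a + (b * q + r * q * (q * m)) * m
  lem = solve-∀

derivative-≡mod′ : Derivative F F₁ → a ≡ b ⟨mod m ⟩ → F₁ a ≡ F₁ b ⟨mod m ⟩
derivative-≡mod′ {F} {F₁} {b = b} {m} D h with q , refl ← mod⇒+ h
  with s , e ← derivative-Lipschitz D b (q * + m) =
  +⇒mod (s * q) (trans e (cong (_+_ (F₁ b)) (sym (ℤ.*-assoc s q (+ m)))))

-- Lifting the exponent for iterates

Σi Σi² : ℕ → ℤ
Σi zero     = 0ℤ
Σi (suc n)  = Σi n + + n
Σi² zero    = 0ℤ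
Σi² (suc n) = Σi² n + + n * + n

2Σi : ∀ n → Σi n * (1ℤ + 1ℤ) ≡ + n * (+ n - 1ℤ)
2Σi zero    = refl
2Σi (suc n) = trans (lem₁ (Σi n) (+ n)) (trans (cong (_+ + n * (1ℤ + 1ℤ)) (2Σi n)) (lem₂ (+ n)))
  where
  lem₁ : ∀ s n → (s + n) * (1ℤ + 1ℤ) ≡ s * (1ℤ + 1ℤ) + n * (1ℤ + 1ℤ)
  lem₁ = solve-∀
  lem₂ : ∀ n → n * (n - 1ℤ) + n * (1ℤ + 1ℤ) ≡ (1ℤ + n) * (1ℤ + n - 1ℤ)
  lem₂ = solve-∀

6Σi² : ∀ n → Σi² n * ((1ℤ + 1ℤ) * (1ℤ + 1ℤ + 1ℤ)) ≡ + n * ((+ n - 1ℤ) * (+ n + + n - 1ℤ))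
6Σi² zero    = refl
6Σi² (suc n) = trans (lem₁ (Σi² n) (+ n))
  (trans (cong (_+ + n * + n * ((1ℤ + 1ℤ) * (1ℤ + 1ℤ + 1ℤ))) (6Σi² n)) (lem₂ (+ n)))
  where
  lem₁ : ∀ s n → (s + n * n) * ((1ℤ + 1ℤ) * (1ℤ + 1ℤ + 1ℤ))
                 ≡ s * ((1ℤ + 1ℤ) * (1ℤ + 1ℤ + 1ℤ)) + n * n * ((1ℤ + 1ℤ) * (1ℤ + 1ℤ + 1ℤ))
  lem₁ = solve-∀
  lem₂ : ∀ n → n * ((n - 1ℤ) * (n + n - 1ℤ)) + n * n * ((1ℤ + 1ℤ) * (1ℤ + 1ℤ + 1ℤ))
               ≡ (1ℤ + n) * ((1ℤ + n - 1ℤ) * (1ℤ + n + (1ℤ + n) - 1ℤ))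
  lem₂ = solve-∀

prime-∤-small : Prime p → ∀ k → suc k < p → ¬ + p ∣ℤ + suc k
prime-∤-small _ k k<p h = ℕ.<⇒≱ k<p (ℕ.∣⇒≤ (∣⇒∣ᵤ h))

prime-odd⇒2< : Prime p → ¬ (2 ∣ p) → 2 < p
prime-odd⇒2< {0} pr _ = contradiction pr ¬prime[0]
prime-odd⇒2< {1} pr _ = contradiction pr ¬prime[1]
prime-odd⇒2< {2} pr 2∤p = contradiction ℕ.∣-refl 2∤p
prime-odd⇒2< {suc (suc (suc p))} pr _ = s≤s (s≤s (s≤s z≤n))

p∣Σi : Prime p → 2 < p → + p ∣ℤ Σi p
p∣Σi {p} pr 2<p with euclidℤ pr (Σi p) (1ℤ + 1ℤ)
  (divides (+ p - 1ℤ) (trans (2Σi p) (ℤ.*-comm (+ p) (+ p - 1ℤ))))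
... | inj₁ h = h
... | inj₂ h = contradiction h (prime-∤-small pr 1 2<p)

-- Here 6 is invertible modulo `p`; for `p = 3` the sum is 5.
p∣Σi² : Prime p → 3 < p → + p ∣ℤ Σi² p
p∣Σi² {p} pr 3<p with euclidℤ pr (Σi² p) ((1ℤ + 1ℤ) * (1ℤ + 1ℤ + 1ℤ))
  (divides ((+ p - 1ℤ) * (+ p + + p - 1ℤ)) (trans (6Σi² p) (ℤ.*-comm (+ p) _)))
... | inj₁ h = h
... | inj₂ h with euclidℤ pr (1ℤ + 1ℤ) (1ℤ + 1ℤ + 1ℤ) h
...   | inj₁ k = contradiction k (prime-∤-small pr 1 (ℕ.<-trans (ℕ.n<1+n 2) 3<p))
...   | inj₂ k = contradiction k (prime-∤-small pr 2 3<p)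

-- With u n = hⁿ(X) - X one has u (n + 1) = P z + (1 + P ℓ) u n + μ (u n)² + r (u n)³; the
-- sums Σi and Σi² come from substituting the first approximation u n ≈ n P z.
iterate-expansion : (S : Smooth h) (X P z ℓ : ℤ) → h X ≡ X + P * z → D¹ S X ≡ 1ℤ + P * ℓ →
  ∀ n → ∃[ w ] iterate h X n ≡
    X + P * z * (+ n + P * (Σi n * ℓ + Σi² n * (D² S X * z) + P * w))
iterate-expansion {h} S X P z ℓ hX λX zero = 0ℤ , lem X P z ℓ (D² S X)
  where
  lem : ∀ X P z ℓ μ → X ≡ X + P * z * (0ℤ + P * (0ℤ * ℓ + 0ℤ * (μ * z) + P * 0ℤ))
  lem = solve-∀
iterate-expansion {h} S X P z ℓ hX λX (suc n)
  with w , e ← iterate-expansion S X P z ℓ hX λX n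
  with r , e′ ← taylor S X (P * z * (+ n + P * (Σi n * ℓ + Σi² n * (D² S X * z) + P * w))) =
  w + ℓ * t + D² S X * z * (+ n * t + + n * t + P * (t * t)) + r * (z * z) * (V * V * V) ,
  trans (iterate-suc h X n) (trans (cong h e) (trans e′
    (trans (cong₂ (λ y l → y + l * (P * z * V) + D² S X * ((P * z * V) * (P * z * V))
        + r * ((P * z * V) * (P * z * V) * (P * z * V))) hX λX)
      (trans (lem₁ X P z ℓ (D² S X) r V) (cong (λ y → X + P * z * y)
        (trans (lem₂ P z ℓ (D² S X) (+ n) t (r * (z * z) * (V * V * V)))
          (lem₃ P z ℓ (D² S X) (+ n) (Σi n) (Σi² n) w (ℓ * t)
            (D² S X * z * (+ n * t + + n * t + P * (t * t))) (r * (z * z) * (V * V * V)))))))))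
  where
  t V : ℤ
  t = Σi n * ℓ + Σi² n * (D² S X * z) + P * w
  V = + n + P * t
  lem₁ : ∀ X P z ℓ μ r V →
    X + P * z + (1ℤ + P * ℓ) * (P * z * V) + μ * ((P * z * V) * (P * z * V))
      + r * ((P * z * V) * (P * z * V) * (P * z * V))
    ≡ X + P * z * (1ℤ + V + P * ℓ * V + P * (μ * z) * (V * V) + P * P * (r * (z * z) * (V * V * V)))
  lem₁ = solve-∀
  lem₂ : ∀ P z ℓ μ n t c →
    1ℤ + (n + P * t) + P * ℓ * (n + P * t) + P * (μ * z) * ((n + P * t) * (n + P * t)) + P * P * c
    ≡ 1ℤ + n + P * (t + n * ℓ + n * n * (μ * z)
      + P * (ℓ * t + μ * z * (n * t + n * t + P * (t * t)) + c))
  lem₂ = solve-∀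
  lem₃ : ∀ P z ℓ μ n s₁ s₂ w a b c →
    1ℤ + n + P * (s₁ * ℓ + s₂ * (μ * z) + P * w + n * ℓ + n * n * (μ * z) + P * (a + b + c))
    ≡ 1ℤ + n + P * ((s₁ + n) * ℓ + (s₂ + n * n) * (μ * z) + P * (w + a + b + c))
  lem₃ = solve-∀

iterate-fixed : (S : Smooth h) → ∀ {X} → h X ≡ X ⟨mod m ⟩ → ∀ n → iterate h X n ≡ X ⟨mod m ⟩
iterate-fixed S e zero    = ≡mod-refl
iterate-fixed S e (suc n) = ≡mod-trans (derivative-≡mod (derivative (smooth-iterate S n)) e)
  (iterate-fixed S e n)

D¹-iterate : (S : Smooth h) → ∀ {X} → h X ≡ X ⟨mod m ⟩ → ∀ n →
  D¹ (smooth-iterate S n) X ≡ D¹ S X ^ℤ n ⟨mod m ⟩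
D¹-iterate S e zero    = ≡mod-refl
D¹-iterate S {X} e (suc n) =
  ≡mod-trans (≡mod-* (≡mod-trans (derivative-≡mod′ (derivative (smooth-iterate S n)) e)
    (D¹-iterate S e n)) ≡mod-refl)
    (≡mod-reflexive (ℤ.*-comm (D¹ S X ^ℤ n) (D¹ S X)))

-- `quad` covers both situations in which the quadratic term is harmless: for `p > 3` one factor `p`
-- comes from `Σi² p` and one from `near`; if p² divides `h X - X`, both come from there.
record Admissible (p : ℕ) (S : Smooth h) (X : ℤ) : Set where
  field
    near : h X ≡ X ⟨mod p ⟩
    mult : D¹ S X ≡ 1ℤ ⟨mod p ⟩
    quad : + p * + p ∣ℤ Σi² p * (h X - X)

open Admissible public

1^ℤ : ∀ n → 1ℤ ^ℤ n ≡ 1ℤ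
1^ℤ zero    = refl
1^ℤ (suc n) = trans (ℤ.*-identityˡ (1ℤ ^ℤ n)) (1^ℤ n)

1+p*w-unit : Prime p → ∀ w → ¬ + p ∣ℤ 1ℤ + + p * w
1+p*w-unit {p} pr w k = contradiction (∣-resp (eq (+ p) w) (∣m∣n⇒∣m+n k (divides (- w) refl)))
  (prime-∤-small pr 0 (prime⇒1< pr))
  where
  eq : ∀ p w → 1ℤ + p * w + - w * p ≡ 1ℤ
  eq = solve-∀

-- In the bracket of `iterate-expansion` at `n = p`, all terms after the leading `p` are divisible
-- by p²: the linear one because `p` divides `Σi p`, the quadratic one by `quad`. So passing to hᵖ
-- raises the valuation by exactly one.
iterate-p : Prime p → 2 < p → (S : Smooth h) → ∀ {X} → Admissible p S X →
  ∃[ w ] iterate h X p - X ≡ (h X - X) * + p * (1ℤ + + p * w)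
iterate-p {p} {h} pr 2<p S {X} A
  with z , hX ← mod⇒+ (near A) | ℓ , λX ← mod⇒+ (mult A)
     | divides s σ₁ ← p∣Σi pr 2<p | divides t σ₂ ← quad A
  with w , e ← iterate-expansion S X (+ p) z ℓ
    (trans hX (cong (_+_ X) (ℤ.*-comm z (+ p)))) (trans λX (cong (_+_ 1ℤ) (ℤ.*-comm ℓ (+ p)))) p
  = s * ℓ + w + D² S X * t ,
  trans (cong (_- X) e) (trans (lem₁ X (+ p) z ℓ (D² S X) (Σi p) (Σi² p) w)
    (trans (cong₂ (λ s₁ s₂ → + p * z * (+ p + + p * (s₁ * ℓ + + p * w)) + + p * z * (D² S X * s₂))
      σ₁ σ₂′)
      (trans (lem₂ (+ p) z ℓ (D² S X) s t w)
        (cong (λ y → y * + p * (1ℤ + + p * (s * ℓ + w + D² S X * t))) (sym z≡)))))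
  where
  lem₀ : ∀ X z p → X + z * p - X ≡ p * z
  lem₀ = solve-∀
  z≡ : h X - X ≡ + p * z
  z≡ = trans (cong (_- X) hX) (lem₀ X z (+ p))
  σ₂′ : Σi² p * (+ p * z) ≡ t * (+ p * + p)
  σ₂′ = trans (cong (Σi² p *_) (sym z≡)) σ₂
  lem₁ : ∀ X P z ℓ μ s₁ s₂ w → X + P * z * (P + P * (s₁ * ℓ + s₂ * (μ * z) + P * w)) - X
       ≡ P * z * (P + P * (s₁ * ℓ + P * w)) + P * z * (μ * (s₂ * (P * z)))
  lem₁ = solve-∀
  lem₂ : ∀ P z ℓ μ s t w → P * z * (P + P * (s * P * ℓ + P * w)) + P * z * (μ * (t * (P * P)))
       ≡ P * z * P * (1ℤ + P * (s * ℓ + w + μ * t))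
  lem₂ = solve-∀

square-admissible : (S : Smooth h) → ∀ {X} → + p * + p ∣ℤ h X - X → D¹ S X ≡ 1ℤ ⟨mod p ⟩ →
  Admissible p S X
square-admissible {p = p} S k l .near = mod (∣-trans (divides (+ p) refl) k)
square-admissible S k l .mult = l
square-admissible {p = p} S k l .quad = ∣n⇒∣m*n (Σi² p) k

private
  lte-coprime : Prime p → (S : Smooth h) → ∀ {X} → Admissible p S X → ∀ N → ¬ p ∣ N →
    ∀ M → + (p ^ M) ∣ℤ iterate h X N - X → + (p ^ M) ∣ℤ h X - X
  lte-coprime {p} {h} pr S {X} A N p∤N M k
    with z , hX ← mod⇒+ (near A) | ℓ , λX ← mod⇒+ (mult A)
    with w , e ← iterate-expansion S X (+ p) z ℓ
      (trans hX (cong (_+_ X) (ℤ.*-comm z (+ p)))) (trans λX (cong (_+_ 1ℤ) (ℤ.*-comm ℓ (+ p)))) N =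
    ∣-resp (sym (trans (cong (_- X) hX) (lem₀ X z (+ p))))
      (pow-∣-cancelʳ pr M (+ p * z) (+ N + + p * t) unit
        (∣-resp (trans (cong (_- X) e) (lem₁ X (+ p * z * (+ N + + p * t)))) k))
    where
    t : ℤ
    t = Σi N * ℓ + Σi² N * (D² S X * z) + + p * w
    lem₀ : ∀ X z p → X + z * p - X ≡ p * z
    lem₀ = solve-∀
    lem₁ : ∀ X y → X + y - X ≡ y
    lem₁ = solve-∀
    lem₂ : ∀ n p t → n + p * t + - t * p ≡ n
    lem₂ = solve-∀
    unit : ¬ + p ∣ℤ + N + + p * t
    unit l = p∤N (∣⇒∣ᵤ (∣-resp (lem₂ (+ N) (+ p) t) (∣m∣n⇒∣m+n l (divides (- t) refl))))

  iterate-p-square : Prime p → 2 < p → (S : Smooth h) → ∀ {X} → Admissible p S X →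
    + p * + p ∣ℤ iterate h X p - X
  iterate-p-square {p} {h} pr 2<p S {X} A = from (mod⇒+ (near A)) (iterate-p pr 2<p S A)
    where
    lem₀ : ∀ X z p → X + z * p - X ≡ z * p
    lem₀ = solve-∀
    lem : ∀ z p u → z * p * p * u ≡ z * u * (p * p)
    lem = solve-∀
    from : ∃[ z ] h X ≡ X + z * + p → ∃[ w ] iterate h X p - X ≡ (h X - X) * + p * (1ℤ + + p * w) →
           + p * + p ∣ℤ iterate h X p - X
    from (z , hX) (w , e) = divides (z * (1ℤ + + p * w)) (trans e
      (trans (cong (λ y → y * + p * (1ℤ + + p * w)) (trans (cong (_- X) hX) (lem₀ X z (+ p))))
        (lem z (+ p) (1ℤ + + p * w))))

  iterate-p-admissible : Prime p → 2 < p → (S : Smooth h) → ∀ {X} → Admissible p S X →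
    Admissible p (smooth-iterate S p) X
  iterate-p-admissible {p} {h} pr 2<p S {X} A =
    square-admissible (smooth-iterate S p) (iterate-p-square pr 2<p S A) mult-p
      where
      mult-p : D¹ (smooth-iterate S p) X ≡ 1ℤ ⟨mod p ⟩
      mult-p = ≡mod-trans (D¹-iterate S (near A) p)
        (≡mod-trans (≡mod-^ p (mult A)) (≡mod-reflexive (1^ℤ p)))

  lte-step : Prime p → 2 < p → (S : Smooth h) → ∀ {X} → Admissible p S X → ∀ N M →
    + (p ^ M) ∣ℤ + N * (iterate h X p - X) → + (p ^ M) ∣ℤ + (N ℕ.* p) * (h X - X)
  lte-step {p} {h} pr 2<p S {X} A N M k = from (iterate-p pr 2<p S A)
    where
    lem : ∀ n z p w → n * (z * p * w) ≡ n * p * z * w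
    lem = solve-∀
    from : ∃[ w ] iterate h X p - X ≡ (h X - X) * + p * (1ℤ + + p * w) →
           + (p ^ M) ∣ℤ + (N ℕ.* p) * (h X - X)
    from (w , e) = subst (λ y → + (p ^ M) ∣ℤ y * (h X - X)) (sym (ℤ.pos-* N p))
      (pow-∣-cancelʳ pr M (+ N * + p * (h X - X)) (1ℤ + + p * w) (1+p*w-unit pr w) (∣-resp eq k))
      where
      eq : + N * (iterate h X p - X) ≡ + N * + p * (h X - X) * (1ℤ + + p * w)
      eq = trans (cong (λ y → + N * y) e) (lem (+ N) (h X - X) (+ p) (1ℤ + + p * w))

-- Strong induction on `N`. If `p` does not divide `N`, the bracket of `iterate-expansion` is prime
-- to `p`. Otherwise the claim is used for hᵖ and `N / p`: hᵖ is admissible because p² divides hᵖ(X)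
-- - X, and `iterate-p` turns this difference into p (h(X) - X) up to a unit.
lte : Prime p → 2 < p → ∀ N → Acc _<_ N → (S : Smooth h) → ∀ {X} → Admissible p S X →
  ∀ M → + (p ^ M) ∣ℤ iterate h X N - X → + (p ^ M) ∣ℤ + N * (h X - X)
lte {p} {h} pr 2<p N (acc rs) S {X} A M k with p ℕ.∣? N
... | no p∤N = ∣n⇒∣m*n (+ N) (lte-coprime pr S A N p∤N M k)
... | yes (ℕ.divides zero refl) = divides 0ℤ refl
... | yes (ℕ.divides N′@(suc _) refl) = lte-step pr 2<p S A N′ M
  (lte pr 2<p N′ (rs (ℕ.m<m*n N′ p (ℕ.<-trans (ℕ.n<1+n 1) 2<p))) (smooth-iterate S p)
    (iterate-p-admissible pr 2<p S A) M (subst (λ y → + (p ^ M) ∣ℤ y - X) (iterate-* h X N′ p) k))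

-- Fermat's little theorem

private
  module ℕSum = Sum (CommutativeSemiring.semiring ℕ.+-*-commutativeSemiring)
  module ℕRaw = RawSemiring (CommutativeSemiring.rawSemiring ℕ.+-*-commutativeSemiring)

  ×≡* : ∀ n x → n ℕRaw.× x ≡ n ℕ.* x
  ×≡* zero    x = refl
  ×≡* (suc n) x = cong (x ℕ.+_) (×≡* n x)

  ^≡^ : ∀ x n → x ℕRaw.^ n ≡ x ^ n
  ^≡^ x zero    = refl
  ^≡^ x (suc n) = cong (x ℕ.*_) (^≡^ x n)

  ∣-sum : ∀ {n} (t : Fin n → ℕ) → (∀ i → m ∣ t i) → m ∣ ℕSum.sum t
  ∣-sum {n = zero}  t h = _ ℕ.∣0
  ∣-sum {n = suc n} t h = ℕ.∣m∣n⇒∣m+n (h zero) (∣-sum (t ∘ suc) (h ∘ suc))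

prime-∤-! : Prime p → ∀ k → k < p → ¬ (p ∣ k !)
prime-∤-! pr zero    k<p h = ℕ.<⇒≱ (prime⇒1< pr) (ℕ.∣⇒≤ h)
prime-∤-! pr (suc k) k<p h with euclidsLemma (suc k) (k !) pr h
... | inj₁ l = ℕ.<⇒≱ k<p (ℕ.∣⇒≤ l)
... | inj₂ l = prime-∤-! pr k (ℕ.<-trans (ℕ.n<1+n k) k<p) l

prime-∣-C : Prime p → ∀ k → 0 < k → k < p → p ∣ p C k
prime-∣-C {p@(suc q)} pr k 0<k k<p
  with euclidsLemma (p C k) (k ! ℕ.* (p ∸ k) !) pr
         (subst (p ∣_) (sym C*≡p!) (ℕ.m∣m*n (q !)))
  where
  instance _ = ℕ.m*n≢0 (k !) ((p ∸ k) !) {{k ℕ.!≢0}} {{(p ∸ k) ℕ.!≢0}}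
  C*≡p! : (p C k) ℕ.* (k ! ℕ.* (p ∸ k) !) ≡ p !
  C*≡p! = trans (cong (λ c → c ℕ.* (k ! ℕ.* (p ∸ k) !)) (nCk≡n!/k![n-k]! (ℕ.<⇒≤ k<p)))
    (m/n*n≡m (k![n∸k]!∣n! (ℕ.<⇒≤ k<p)))
... | inj₁ h = h
... | inj₂ h with euclidsLemma (k !) ((p ∸ k) !) pr h
...   | inj₁ l = contradiction l (prime-∤-! pr k k<p)
...   | inj₂ l = contradiction l (prime-∤-! pr (p ∸ k) (ℕ.∸-monoʳ-< 0<k (ℕ.<⇒≤ k<p)))

freshman : Prime p → ∀ x → ∃[ s ] p ∣ s × (x ℕ.+ 1) ^ p ≡ 1 ℕ.+ (s ℕ.+ x ^ p)
freshman {p@(suc q)} pr x = ℕSum.sum mid , ∣-sum mid mid∣ ,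
  trans (sym (^≡^ (x ℕ.+ 1) p)) (trans (theorem p x 1)
    (cong₂ ℕ._+_ first (trans (ℕSum.sum-init-last (term ∘ suc)) (cong (ℕSum.sum mid ℕ.+_) last))))
  where
  open Binomial ℕ.+-*-commutativeSemiring using (theorem; binomialTerm)
  term : Fin (suc p) → ℕ
  term = binomialTerm x 1 p
  mid : Fin q → ℕ
  mid i = term (suc (inject₁ i))
  1^ : ∀ n → 1 ℕRaw.^ n ≡ 1
  1^ n = trans (^≡^ 1 n) (ℕ.^-zeroˡ n)
  first : term zero ≡ 1
  first = trans (×≡* (p C 0) _) (trans (ℕ.*-identityˡ _) (trans (ℕ.*-identityˡ _) (1^ p)))
  last : term (fromℕ p) ≡ x ^ p
  last = trans (cong (λ k → (p C k) ℕRaw.× ((x ℕRaw.^ k) ℕ.* (1 ℕRaw.^ (p ∸ k)))) (Fin.toℕ-fromℕ p))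
    (trans (×≡* (p C p) _) (trans (cong (ℕ._* ((x ℕRaw.^ p) ℕ.* (1 ℕRaw.^ (p ∸ p)))) (nCn≡1 p))
      (trans (ℕ.*-identityˡ _)
        (trans (cong₂ ℕ._*_ (^≡^ x p) (1^ (p ∸ p))) (ℕ.*-identityʳ _)))))
  mid∣ : ∀ i → p ∣ mid i
  mid∣ i = subst (p ∣_) (sym (×≡* (p C suc (toℕ (inject₁ i))) _))
    (ℕ.∣m⇒∣m*n _ (prime-∣-C pr _ (s≤s z≤n)
      (s≤s (subst (_< q) (sym (Fin.toℕ-inject₁ i)) (Fin.toℕ<n i)))))

pos-^ : ∀ m n → + (m ^ n) ≡ (+ m) ^ℤ n
pos-^ m zero    = refl
pos-^ m (suc n) = trans (ℤ.pos-* m (m ^ n)) (cong (_*_ (+ m)) (pos-^ m n))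

fermat-ℕ : Prime p → ∀ x → + (x ^ p) ≡ + x ⟨mod p ⟩
fermat-ℕ {suc q} pr zero    = ≡mod-refl
fermat-ℕ {p} pr (suc x) with s , divides-s , e ← freshman pr x =
  ≡mod-trans (≡mod-reflexive (cong +_ (trans (cong (_^ p) (ℕ.+-comm 1 x)) e)))
    (≡mod-+ {a = 1ℤ} {1ℤ} ≡mod-refl
      (≡mod-trans (≡mod-+ s≡0 (fermat-ℕ pr x)) (≡mod-reflexive (ℤ.+-identityˡ (+ x)))))
  where
  s≡0 : + s ≡ 0ℤ ⟨mod p ⟩
  s≡0 = mod (∣-resp (sym (ℤ.+-identityʳ (+ s))) (∣ᵤ⇒∣ divides-s))

fermat : Prime p → ∀ a → ¬ + p ∣ℤ a → a ^ℤ (p ∸ 1) ≡ 1ℤ ⟨mod p ⟩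
fermat {p@(suc q)} pr a p∤a = mod (cancel (∣-resp (lem a (a ^ℤ q)) (unmod a^p)))
  where
  x : ℕ
  x = a ℤ.%ℕ p
  a≡x : a ≡ + x ⟨mod p ⟩
  a≡x = ≡mod-sym (≡mod-%ℕ a p)
  a^p : a ^ℤ p ≡ a ⟨mod p ⟩
  a^p = ≡mod-trans (≡mod-^ p a≡x) (≡mod-trans (≡mod-reflexive (sym (pos-^ x p)))
          (≡mod-trans (fermat-ℕ pr x) (≡mod-sym a≡x)))
  lem : ∀ a b → a * b - a ≡ (b - 1ℤ) * a
  lem = solve-∀
  cancel : + p ∣ℤ (a ^ℤ q - 1ℤ) * a → + p ∣ℤ a ^ℤ q - 1ℤ
  cancel h with euclidℤ pr (a ^ℤ q - 1ℤ) a h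
  ... | inj₁ k = k
  ... | inj₂ k = contradiction k p∤a

-- Lengths of periodic orbits

residue-eval : ∀ f (x : ℤₚ p) n → residue (eval f x) n ≡ evalℤ f (residue x n)
residue-eval []      x n = refl
residue-eval (a ∷ f) x n = cong (λ y → a + residue x n * y) (residue-eval f x n)

residue-iterate : ∀ f k (x : ℤₚ p) n →
  residue (iterate (eval f) x k) n ≡ iterate (evalℤ f) (residue x n) k
residue-iterate f zero    x n = refl
residue-iterate f (suc k) x n =
  trans (residue-iterate f k (eval f x) n) (cong (λ y → iterate (evalℤ f) y k) (residue-eval f x n))

residue-≤ : ∀ (x : ℤₚ p) {m n} → m ≤ n → residue x n ≡ residue x m ⟨mod p ^ m ⟩
residue-≤ x {m} m≤n = go (ℕ.≤⇒≤′ m≤n)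
  where
  go : ∀ {n} → m ℕ.≤′ n → residue x n ≡ residue x m ⟨mod _ ^ m ⟩
  go ℕ.≤′-refl     = ≡mod-refl
  go (ℕ.≤′-step l) = ≡mod-trans (≡mod-∣ (pow-mono-∣ (ℕ.≤′⇒≤ l)) (mod (coherent x _))) (go l)

module _ {p : ℕ} where
  open Setoid (ℤₚ-setoid p) public using ()
    renaming (refl to ≈ₚ-refl; sym to ≈ₚ-sym; trans to ≈ₚ-trans)

iterate-eval-cong : ∀ f k {x y : ℤₚ p} → x ≈ₚ y → iterate (eval f) x k ≈ₚ iterate (eval f) y k
iterate-eval-cong f k {x} {y} e = mk≈ λ n → unmod
  (≡mod-trans (≡mod-reflexive (residue-iterate f k x n))
    (≡mod-trans (derivative-≡mod (derivative (smooth-iterate (smooth-evalℤ f) k))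
      (mod (residue-≡ e n)))
      (≡mod-reflexive (sym (residue-iterate f k y n)))))

iterate-swap : ∀ {A : Set} (f : A → A) x m n →
  iterate (λ y → iterate f y m) x n ≡ iterate (λ y → iterate f y n) x m
iterate-swap f x m n =
  trans (sym (iterate-* f x n m)) (trans (cong (iterate f x) (ℕ.*-comm n m)) (iterate-* f x m n))

iterate-return : (S : Smooth h) → ∀ {X} c k → + n ∣ℤ iterate h X c - X →
  + n ∣ℤ iterate (λ Y → iterate h Y k) X c - X
iterate-return {h} {n} S {X} c k e = subst (λ y → + n ∣ℤ y - X) (iterate-swap h X c k)
  (unmod (iterate-fixed (smooth-iterate S c) {X} (mod e) k))

-- The finite-precision shadow of hᵏ(x) = x for a point of period `c`. The factor `c` costs at most
-- v(c) digits, a loss independent of `M`.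
ReturnsAfter : (p : ℕ) (h : ℤ → ℤ) (X : ℤ) (k : ℕ) → Set
ReturnsAfter p h X k = ∀ c M → + (p ^ M) ∣ℤ iterate h X c - X →
  + (p ^ M) ∣ℤ + c * (iterate h X k - X)

admissible-returns : Prime p → 2 < p → (S : Smooth h) → ∀ {X} k →
  Admissible p (smooth-iterate S k) X → ReturnsAfter p h X k
admissible-returns pr 2<p S k A c M e =
  lte pr 2<p c (<-wellFounded c) (smooth-iterate S k) A M (iterate-return S c k e)

-- When `P` divides the derivative, the linear and the quadratic term of a displacement divisible by
-- `P * z` both gain a further `P`, so the first displacement dominates.
nilpotent-expansion : Derivative h h₁ → ∀ X P z ℓ → h X ≡ X + P * z → h₁ X ≡ P * ℓ →
  ∀ n → ∃[ w ] iterate h X (suc n) ≡ X + P * z * (1ℤ + P * w)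
nilpotent-expansion D X P z ℓ hX λX zero = 0ℤ , trans hX (lem X P z)
  where
  lem : ∀ X P z → X + P * z ≡ X + P * z * (1ℤ + P * 0ℤ)
  lem = solve-∀
nilpotent-expansion {h} {h₁} D X P z ℓ hX λX (suc n) = from (nilpotent-expansion D X P z ℓ hX λX n)
  where
  lem : ∀ X P z ℓ r V → X + P * z + P * ℓ * (P * z * V) + r * ((P * z * V) * (P * z * V))
        ≡ X + P * z * (1ℤ + P * (ℓ * V + r * z * (V * V)))
  lem = solve-∀
  from : ∃[ w ] iterate h X (suc n) ≡ X + P * z * (1ℤ + P * w) →
         ∃[ w ] iterate h X (suc (suc n)) ≡ X + P * z * (1ℤ + P * w)
  from (w , e) = from′ (expand D X (P * z * (1ℤ + P * w)))
    where
    V : ℤ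
    V = 1ℤ + P * w
    from′ : ∃[ r ] h (X + P * z * V) ≡ h X + h₁ X * (P * z * V) + r * ((P * z * V) * (P * z * V)) →
            ∃[ w ] iterate h X (suc (suc n)) ≡ X + P * z * (1ℤ + P * w)
    from′ (r , e′) = ℓ * V + r * z * (V * V) ,
      trans (iterate-suc h X (suc n)) (trans (cong h e) (trans e′
        (trans (cong₂ (λ y l → y + l * (P * z * V) + r * ((P * z * V) * (P * z * V))) hX λX)
          (lem X P z ℓ r V))))

nilpotent-returns : Prime p → (S : Smooth h) → ∀ {X} → h X ≡ X ⟨mod p ⟩ → + p ∣ℤ D¹ S X →
  ReturnsAfter p h X 1
nilpotent-returns pr S near λ0 zero    M e = divides 0ℤ refl
nilpotent-returns {p} {h} pr S {X} near (divides ℓ λX) (suc c) M e = from (mod⇒+ near)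
  where
  lem₀ : ∀ X z p → X + z * p - X ≡ p * z
  lem₀ = solve-∀
  lem₁ : ∀ X y → X + y - X ≡ y
  lem₁ = solve-∀
  from : ∃[ z ] h X ≡ X + z * + p → + (p ^ M) ∣ℤ + suc c * (h X - X)
  from (z , hX) = from′ (nilpotent-expansion (derivative S) X (+ p) z ℓ
      (trans hX (cong (_+_ X) (ℤ.*-comm z (+ p)))) (trans λX (ℤ.*-comm ℓ (+ p))) c)
    where
    from′ : ∃[ w ] iterate h X (suc c) ≡ X + + p * z * (1ℤ + + p * w) →
      + (p ^ M) ∣ℤ + suc c * (h X - X)
    from′ (w , q) = ∣n⇒∣m*n (+ suc c) (∣-resp (sym (trans (cong (_- X) hX) (lem₀ X z (+ p))))
      (pow-∣-cancelʳ pr M (+ p * z) (1ℤ + + p * w) (1+p*w-unit pr w)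
        (∣-resp (trans (cong (_- X) q) (lem₁ X (+ p * z * (1ℤ + + p * w)))) e)))

unit-returns : Prime p → 3 < p → (S : Smooth h) → ∀ {X} → h X ≡ X ⟨mod p ⟩ → ¬ + p ∣ℤ D¹ S X →
  ReturnsAfter p h X (p ∸ 1)
unit-returns {p} {h} pr 3<p S {X} hX λX =
  admissible-returns pr (ℕ.<-trans (ℕ.n<1+n 2) 3<p) S (p ∸ 1) A
  where
  A : Admissible p (smooth-iterate S (p ∸ 1)) X
  A .near = iterate-fixed S hX (p ∸ 1)
  A .mult = ≡mod-trans (D¹-iterate S hX (p ∸ 1)) (fermat pr (D¹ S X) λX)
  A .quad = from (p∣Σi² pr 3<p) (unmod (iterate-fixed S hX (p ∸ 1)))
    where
    lem : ∀ s z p → s * p * (z * p) ≡ s * z * (p * p)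
    lem = solve-∀
    from : + p ∣ℤ Σi² p → + p ∣ℤ iterate h X (p ∸ 1) - X →
      + p * + p ∣ℤ Σi² p * (iterate h X (p ∸ 1) - X)
    from (divides s e) (divides z e′) = divides (s * z) (trans (cong₂ _*_ e e′) (lem s z (+ p)))

-- One factor `p` of hᵖ(X) - X comes from h(X) - X and another from the bracket of
-- `iterate-expansion`, so hᵖ is admissible whatever `Σi² p` is.
one-returns : Prime p → 2 < p → (S : Smooth h) → ∀ {X} → h X ≡ X ⟨mod p ⟩ → D¹ S X ≡ 1ℤ ⟨mod p ⟩ →
  ReturnsAfter p h X p
one-returns {p} {h} pr 2<p S {X} near mult = admissible-returns pr 2<p S p
  (square-admissible (smooth-iterate S p) (from (mod⇒+ near) (mod⇒+ mult))
    (≡mod-trans (D¹-iterate S near p) (≡mod-trans (≡mod-^ p mult) (≡mod-reflexive (1^ℤ p)))))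
  where
  lem : ∀ X P z t → X + P * z * (P + P * t) - X ≡ z * (1ℤ + t) * (P * P)
  lem = solve-∀
  from : ∃[ z ] h X ≡ X + z * + p → ∃[ ℓ ] D¹ S X ≡ 1ℤ + ℓ * + p → + p * + p ∣ℤ iterate h X p - X
  from (z , hX) (ℓ , λX) = from′ (iterate-expansion S X (+ p) z ℓ
      (trans hX (cong (_+_ X) (ℤ.*-comm z (+ p)))) (trans λX (cong (_+_ 1ℤ) (ℤ.*-comm ℓ (+ p)))) p)
    where
    from′ : ∃[ w ] iterate h X p
              ≡ X + + p * z * (+ p + + p * (Σi p * ℓ + Σi² p * (D² S X * z) + + p * w)) →
            + p * + p ∣ℤ iterate h X p - X
    from′ (w , e) = divides (z * (1ℤ + t)) (trans (cong (_- X) e) (lem X (+ p) z t))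
      where
      t : ℤ
      t = Σi p * ℓ + Σi² p * (D² S X * z) + + p * w

-- With multiplier -1 the displacements of two successive steps cancel to first order, which leaves
-- a multiple of p².
minus-one-returns : Prime p → 2 < p → (S : Smooth h) → ∀ {X} → h X ≡ X ⟨mod p ⟩ →
  D¹ S X ≡ -1ℤ ⟨mod p ⟩ → ReturnsAfter p h X 2
minus-one-returns {p} {h} pr 2<p S {X} near mult = admissible-returns pr 2<p S 2
  (square-admissible (smooth-iterate S 2) (from (mod⇒+ near) (mod⇒+ mult))
    (≡mod-trans (D¹-iterate S near 2) (≡mod-^ 2 mult)))
  where
  lem : ∀ X P z ℓ r → X + z * P + (-1ℤ + ℓ * P) * (z * P) + r * ((z * P) * (z * P)) - X
    ≡ (ℓ * z + r * (z * z)) * (P * P)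
  lem = solve-∀
  from : ∃[ z ] h X ≡ X + z * + p → ∃[ ℓ ] D¹ S X ≡ -1ℤ + ℓ * + p → + p * + p ∣ℤ iterate h X 2 - X
  from (z , hX) (ℓ , λX) = from′ (expand (derivative S) X (z * + p))
    where
    from′ : ∃[ r ] h (X + z * + p) ≡ h X + D¹ S X * (z * + p) + r * ((z * + p) * (z * + p)) →
            + p * + p ∣ℤ iterate h X 2 - X
    from′ (r , e) = divides (ℓ * z + r * (z * z)) (trans (cong (_- X) (trans (cong h hX) (trans e
      (cong₂ (λ y l → y + l * (z * + p) + r * ((z * + p) * (z * + p))) hX λX))))
        (lem X (+ p) z ℓ r))

-- Source of explicit precisions: a nonzero integer `c` is not divisible by p^|c|, so |c| bounds its
-- valuation.
n<p^n : 1 < p → ∀ n → n < p ^ n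
n<p^n 1<p zero    = s≤s z≤n
n<p^n {p} 1<p (suc n) = ℕ.≤-<-trans (n<p^n 1<p n)
  (subst (p ^ n <_) (ℕ.*-comm (p ^ n) p)
    (ℕ.m<m*n (p ^ n) p {{ℕ.>-nonZero (ℕ.≤-<-trans z≤n (n<p^n 1<p n))}} 1<p))

pow-∤-self : 1 < p → ∀ n → 0 < n → ¬ + (p ^ n) ∣ℤ + n
pow-∤-self 1<p n@(suc _) _ k = ℕ.<⇒≱ (n<p^n 1<p n) (ℕ.∣⇒≤ (∣⇒∣ᵤ k))

-- To obtain `M` digits, work at precision `M + c`: since p^c does not divide `c`, cancelling the
-- factor `c` costs at most `c` digits.
returns⇒≈ : Prime p → ∀ f (x : ℤₚ p) a k c → 0 < c → iterate (eval f) x c ≈ₚ x →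
  (∀ n → 1 ≤ n → ReturnsAfter p (λ Y → iterate (evalℤ f) Y a) (residue x n) k) →
  iterate (eval f) x (k ℕ.* a) ≈ₚ x
returns⇒≈ {p} pr f x a k c 0<c closed returns = mk≈ λ M → unmod (at M)
  where
  fixed : ∀ n → + (p ^ n) ∣ℤ iterate (evalℤ f) (residue x n) c - residue x n
  fixed n = subst (λ y → + (p ^ n) ∣ℤ y - residue x n) (residue-iterate f c x n)
    (residue-≡ closed n)
  at : ∀ M → residue (iterate (eval f) x (k ℕ.* a)) M ≡ residue x M ⟨mod p ^ M ⟩
  at M = ≡mod-trans (≡mod-sym (residue-≤ (iterate (eval f) x (k ℕ.* a)) M≤N))
    (≡mod-trans (mod (subst (λ y → + (p ^ M) ∣ℤ y - residue x (M ℕ.+ c)) eq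
      (pow-∣-split pr c M Δ (+ c) (∣-resp (ℤ.*-comm (+ c) Δ)
        (returns N (ℕ.≤-trans 0<c (ℕ.m≤n+m c M)) c N
          (iterate-return (smooth-evalℤ f) c a (fixed N))))
        (pow-∤-self (prime⇒1< pr) c 0<c))))
      (residue-≤ x M≤N))
    where
    N : ℕ
    N = M ℕ.+ c
    M≤N : M ≤ N
    M≤N = ℕ.m≤m+n M c
    Δ : ℤ
    Δ = iterate (λ Y → iterate (evalℤ f) Y a) (residue x N) k - residue x N
    eq : iterate (λ Y → iterate (evalℤ f) Y a) (residue x N) k
         ≡ residue (iterate (eval f) x (k ℕ.* a)) N
    eq = trans (sym (iterate-* (evalℤ f) (residue x N) k a)) (sym (residue-iterate f (k ℕ.* a) x N))

residue-near : (x : ℤₚ p) → 1 ≤ n → residue x n ≡ residue x 1 ⟨mod p ⟩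
residue-near {p} x 1≤n = ≡mod-∣ (p∣pow {p} {0}) (residue-≤ x 1≤n)

collision : ∀ m .{{_ : ℕ.NonZero m}} (s : ℕ → ℤ) →
  ∃[ i ] ∃[ a ] 1 ≤ a × a ≤ m × s (i ℕ.+ a) ≡ s i ⟨mod m ⟩
collision m s = from (Fin.pigeonhole (ℕ.n<1+n m) class)
  where
  class : Fin (suc m) → Fin m
  class i = fromℕ< (ℤ.n%ℕd<d (s (toℕ i)) m)
  from : (∃[ i ] ∃[ j ] i Fin.< j × class i ≡ class j) → _
  from (i , j , i<j , e) = toℕ i , toℕ j ∸ toℕ i , ℕ.m<n⇒0<n∸m i<j ,
    ℕ.≤-trans (ℕ.m∸n≤m (toℕ j) (toℕ i)) (ℕ.s≤s⁻¹ (Fin.toℕ<n j)) ,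
    ≡mod-trans (≡mod-reflexive (cong s (ℕ.m+[n∸m]≡n (ℕ.<⇒≤ i<j))))
      (≡mod-sym (%ℕ-≡mod (s (toℕ i)) (s (toℕ j)) m (Fin.fromℕ<-injective _ _ _ _ e)))

-- The pigeonhole principle only gives hⁱ⁺ᵃ(X) ≡ hⁱ(X). A further `i * c` steps turn `i` into
-- `i * suc c`, a multiple of the known period, and leave hᵃ(X) ≡ X.
periodic-return : Smooth h → ∀ m .{{_ : ℕ.NonZero m}} X c → iterate h X (suc c) ≡ X ⟨mod m ⟩ →
  ∃[ a ] 1 ≤ a × a ≤ m × iterate h X a ≡ X ⟨mod m ⟩
periodic-return {h} S m X c e = from (collision m (iterate h X))
  where
  from : (∃[ i ] ∃[ a ] 1 ≤ a × a ≤ m × iterate h X (i ℕ.+ a) ≡ iterate h X i ⟨mod m ⟩) →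
         ∃[ a ] 1 ≤ a × a ≤ m × iterate h X a ≡ X ⟨mod m ⟩
  from (i , a , 1≤a , a≤m , r) = a , 1≤a , a≤m ,
    ≡mod-trans (≡mod-sym (cong-iterate a full))
      (≡mod-trans (≡mod-reflexive commute) (≡mod-trans (cong-iterate (i ℕ.* c) r) full′))
    where
    cong-iterate : ∀ k {Y Z} → Y ≡ Z ⟨mod m ⟩ → iterate h Y k ≡ iterate h Z k ⟨mod m ⟩
    cong-iterate k = derivative-≡mod (derivative (smooth-iterate S k))
    full : iterate h X (i ℕ.* suc c) ≡ X ⟨mod m ⟩
    full = ≡mod-trans (≡mod-reflexive (iterate-* h X i (suc c)))
      (iterate-fixed (smooth-iterate S (suc c)) e i)
    full′ : iterate h (iterate h X i) (i ℕ.* c) ≡ X ⟨mod m ⟩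
    full′ = ≡mod-trans
      (≡mod-reflexive
        (trans (sym (iterate-+ h X i (i ℕ.* c))) (cong (iterate h X) (sym (ℕ.*-suc i c)))))
      full
    commute : iterate h (iterate h X (i ℕ.* suc c)) a ≡ iterate h (iterate h X (i ℕ.+ a)) (i ℕ.* c)
    commute = trans (sym (iterate-+ h X (i ℕ.* suc c) a))
      (trans (cong (iterate h X) arith) (iterate-+ h X (i ℕ.+ a) (i ℕ.* c)))
      where
      arith : i ℕ.* suc c ℕ.+ a ≡ i ℕ.+ a ℕ.+ i ℕ.* c
      arith = trans (cong (ℕ._+ a) (ℕ.*-suc i c)) (trans (ℕ.+-assoc i (i ℕ.* c) a)
        (trans (cong (i ℕ.+_) (ℕ.+-comm (i ℕ.* c) a)) (sym (ℕ.+-assoc i a (i ℕ.* c)))))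

-- From return times to the length of an orbit

module Cycle (pr : Prime p) (f : ℤ[x]) (O : PeriodicOrbit p f) where

  private
    instance _ = prime⇒nonZero pr

    x : ℤₚ p
    x = base O

    returnTime : ∃[ a ] 1 ≤ a × a ≤ p × iterate (evalℤ f) (residue x 1) a ≡ residue x 1 ⟨mod p ⟩
    returnTime with length O | positive O | closed O
    ... | suc c | _ | e = periodic-return (smooth-evalℤ f) p (residue x 1) c
      (≡mod-trans (≡mod-reflexive (sym (residue-iterate f (suc c) x 1)))
        (≡mod-∣ (p∣pow {p} {0}) (mod (residue-≡ e 1))))

    -- A return time modulo `p` found by the pigeonhole principle; it may fail to be the least one,
    -- and enters through its bounds `1≤a` and `a≤p`.
    firstReturn : ℕ
    firstReturn = proj₁ returnTime

    1≤a : 1 ≤ firstReturn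
    1≤a = proj₁ (proj₂ returnTime)

    a≤p : firstReturn ≤ p
    a≤p = proj₁ (proj₂ (proj₂ returnTime))

    S : Smooth (λ Y → iterate (evalℤ f) Y firstReturn)
    S = smooth-iterate (smooth-evalℤ f) firstReturn

    near-x : ∀ n → 1 ≤ n → iterate (evalℤ f) (residue x n) firstReturn ≡ residue x n ⟨mod p ⟩
    near-x n 1≤n = ≡mod-trans (derivative-≡mod (derivative S) (residue-near x 1≤n))
      (≡mod-trans (proj₂ (proj₂ (proj₂ returnTime))) (≡mod-sym (residue-near x 1≤n)))

    D¹-near : ∀ n → 1 ≤ n → D¹ S (residue x n) ≡ D¹ S (residue x 1) ⟨mod p ⟩
    D¹-near n 1≤n = derivative-≡mod′ (derivative S) (residue-near x 1≤n)

    returns : ∀ k →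
      (∀ n → 1 ≤ n → ReturnsAfter p (λ Y → iterate (evalℤ f) Y firstReturn) (residue x n) k) →
      iterate (eval f) x (k ℕ.* firstReturn) ≈ₚ x
    returns k = returns⇒≈ pr f x firstReturn k (length O) (positive O) (closed O)

  return-p>3 : 3 < p → ∃[ a ] ∃[ d ] 1 ≤ a × a ≤ p × d ∣ p ∸ 1 × iterate (eval f) x (d ℕ.* a) ≈ₚ x
  return-p>3 3<p with + p ∣? D¹ S (residue x 1)
  ... | yes l = firstReturn , 1 , 1≤a , a≤p , ℕ.1∣ (p ∸ 1) ,
    returns 1 (λ n 1≤n → nilpotent-returns pr S (near-x n 1≤n)
      (≡mod⇒∣ (≡mod-sym (D¹-near n 1≤n)) l))
  ... | no l = firstReturn , p ∸ 1 , 1≤a , a≤p , ℕ.∣-refl ,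
    returns (p ∸ 1) (λ n 1≤n → unit-returns pr 3<p S (near-x n 1≤n) (l ∘ ≡mod⇒∣ (D¹-near n 1≤n)))

  return-p≡3 : p ≡ 3 →
    ∃[ a ] ∃[ d ] 1 ≤ a × a ≤ 3 × (d ∣ 2 ⊎ d ≡ 3) × iterate (eval f) x (d ℕ.* a) ≈ₚ x
  return-p≡3 refl = split (D¹ S (residue x 1) ℤ.%ℕ 3) refl (ℤ.n%ℕd<d (D¹ S (residue x 1)) 3)
    where
    2<3 : 2 < 3
    2<3 = s≤s (s≤s (s≤s z≤n))
    split : ∀ r → D¹ S (residue x 1) ℤ.%ℕ 3 ≡ r → r < 3 →
      ∃[ a ] ∃[ d ] 1 ≤ a × a ≤ 3 × (d ∣ 2 ⊎ d ≡ 3) × iterate (eval f) x (d ℕ.* a) ≈ₚ x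
    split 0 e _ = firstReturn , 1 , 1≤a , a≤p , inj₁ (ℕ.1∣ 2) ,
      returns 1 (λ n 1≤n → nilpotent-returns pr S (near-x n 1≤n)
        (≡mod⇒∣ (≡mod-sym (≡mod-trans (D¹-near n 1≤n) (%ℕ-≡mod (D¹ S (residue x 1)) 0ℤ 3 e)))
          (divides 0ℤ refl)))
    split 1 e _ = firstReturn , 3 , 1≤a , a≤p , inj₂ refl ,
      returns 3 (λ n 1≤n → one-returns pr 2<3 S (near-x n 1≤n)
        (≡mod-trans (D¹-near n 1≤n) (%ℕ-≡mod (D¹ S (residue x 1)) 1ℤ 3 e)))
    split 2 e _ = firstReturn , 2 , 1≤a , a≤p , inj₁ ℕ.∣-refl ,
      returns 2 (λ n 1≤n → minus-one-returns pr 2<3 S (near-x n 1≤n)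
        (≡mod-trans (D¹-near n 1≤n) (%ℕ-≡mod (D¹ S (residue x 1)) -1ℤ 3 e)))
    split (suc (suc (suc r))) _ (s≤s (s≤s (s≤s ())))

  -- The remainder of `k` modulo the length is again a return time, and `distinct` forces it to be
  -- 0.
  length-∣ : ∀ k → iterate (eval f) x k ≈ₚ x → length O ∣ k
  length-∣ k e = from (length O) refl
    where
    fixed : ∀ q → iterate (λ y → iterate (eval f) y (length O)) x q ≈ₚ x
    fixed zero    = ≈ₚ-refl
    fixed (suc q) = ≈ₚ-trans
      (subst₂ _≈ₚ_ (iterate-* (eval f) _ q (length O)) (iterate-* (eval f) x q (length O))
      (iterate-eval-cong f (q ℕ.* length O) (closed O))) (fixed q)
    from : ∀ c → length O ≡ c → c ∣ k
    from zero    q = contradiction (subst (1 ≤_) q (positive O)) λ ()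
    from (suc c) q = ℕ.m%n≡0⇒n∣m k (suc c)
      (trans (sym (Fin.toℕ-fromℕ< r<)) (trans (cong toℕ i≡0) (Fin.toℕ-fromℕ< (positive O))))
      where
      r : ℕ
      r = k % suc c
      r< : r < length O
      r< = subst (r <_) (sym q) (m%n<n k (suc c))
      fʳx≈x : iterate (eval f) x r ≈ₚ x
      fʳx≈x = ≈ₚ-trans (≈ₚ-sym (iterate-eval-cong f r (fixed (k / suc c))))
        (subst (_≈ₚ x) (trans (cong (iterate (eval f) x) k≡)
          (trans (iterate-+ (eval f) x (k / suc c ℕ.* length O) r)
            (cong (λ y → iterate (eval f) y r) (iterate-* (eval f) x (k / suc c) (length O))))) e)
        where
        k≡ : k ≡ k / suc c ℕ.* length O ℕ.+ r
        k≡ = trans (m≡m%n+[m/n]*n k (suc c))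
          (trans (ℕ.+-comm r _) (cong (λ l → k / suc c ℕ.* l ℕ.+ r) (sym q)))
      i≡0 : fromℕ< r< ≡ fromℕ< (positive O)
      i≡0 = distinct O (subst₂ _≈ₚ_ (cong (iterate (eval f) x) (sym (Fin.toℕ-fromℕ< r<)))
        (cong (iterate (eval f) x) (sym (Fin.toℕ-fromℕ< (positive O)))) fʳx≈x)

-- The bounded factor is `gcd c a`. As `c` divides `d * c` and `d * a`, it divides `d * gcd c a`;
-- cancelling the gcd shows that the cofactor divides `d`.
product-of-factors : ∀ {a d c} → 1 ≤ c → a ≤ m → d ∣ n → c ∣ d ℕ.* a → 1 ≤ a → ProductOf≤And∣ m n c
product-of-factors {m} {n} {a} {d} {c} 1≤c a≤m d∣n c∣da 1≤a = from (gcd[m,n]∣m c a)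
  where
  instance _ = ℕ.>-nonZero 1≤a
  c∣ : c ∣ d ℕ.* gcd c a
  c∣ = subst (c ∣_) (sym (c*gcd[m,n]≡gcd[cm,cn] d c a)) (gcd-greatest (ℕ.∣n⇒∣m*n d ℕ.∣-refl) c∣da)
  from : gcd c a ∣ c → ProductOf≤And∣ m n c
  from (ℕ.divides q e) = gcd c a , q , 1≤g , ℕ.≤-trans (gcd[m,n]≤n c a) a≤m ,
    ℕ.∣-trans (ℕ.*-cancelʳ-∣ (gcd c a) {{ℕ.>-nonZero 1≤g}} (subst (_∣ d ℕ.* gcd c a) e c∣)) d∣n ,
      trans e (ℕ.*-comm q (gcd c a))
    where
    1≤g : 1 ≤ gcd c a
    1≤g = ℕ.n≢0⇒n>0 (λ g≡0 → ℕ.n>0⇒n≢0 1≤c (trans e (trans (cong (q ℕ.*_) g≡0) (ℕ.*-zeroʳ q))))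

divisors-of-9 : ∀ c → c ∣ 9 → c ≤ 3 ⊎ c ≡ 9
divisors-of-9 c h = subst (λ c → c ≤ 3 ⊎ c ≡ 9) (Fin.toℕ-fromℕ< c<10)
  (table (fromℕ< c<10) (subst (_∣ 9) (sym (Fin.toℕ-fromℕ< c<10)) h))
  where
  c<10 : c < 10
  c<10 = s≤s (ℕ.∣⇒≤ h)
  table : ∀ (i : Fin 10) → toℕ i ∣ 9 → toℕ i ≤ 3 ⊎ toℕ i ≡ 9
  table = from-yes (Fin.all? {n = 10} λ i →
    (toℕ i ℕ.∣? 9) →-dec ((toℕ i ℕ.≤? 3) ⊎-dec (toℕ i ℕ.≟ 9)))

length-p>3 : Prime p → 3 < p → ∀ f (O : PeriodicOrbit p f) → ProductOf≤And∣ p (p ∸ 1) (length O)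
length-p>3 pr 3<p f O with a , d , 1≤a , a≤p , d∣ , e ← Cycle.return-p>3 pr f O 3<p =
  product-of-factors (positive O) a≤p d∣ (Cycle.length-∣ pr f O (d ℕ.* a) e) 1≤a

divisor-p≡3 : ∀ {a d c} → 1 ≤ c → 1 ≤ a → a ≤ 3 → d ∣ 2 ⊎ d ≡ 3 → c ∣ d ℕ.* a →
  ProductOf≤And∣ 3 2 c ⊎ c ≡ 9
divisor-p≡3 1≤c 1≤a a≤3 (inj₁ d∣2) c∣ = inj₁ (product-of-factors 1≤c a≤3 d∣2 c∣ 1≤a)
-- For `d = 3` and `a` equal to 1 or 2 the factors trade places: 3 becomes the bounded factor and
-- `a` the divisor of 2.
divisor-p≡3 {1} 1≤c _ _ (inj₂ refl) c∣ =
  inj₁ (product-of-factors {a = 3} {d = 1} 1≤c ℕ.≤-refl (ℕ.1∣ 2) c∣ (s≤s z≤n))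
divisor-p≡3 {2} 1≤c _ _ (inj₂ refl) c∣ =
  inj₁ (product-of-factors {a = 3} {d = 2} 1≤c ℕ.≤-refl ℕ.∣-refl c∣ (s≤s z≤n))
divisor-p≡3 {3} {c = c} 1≤c _ _ (inj₂ refl) c∣ with divisors-of-9 c c∣
... | inj₁ c≤3 = inj₁ (c , 1 , 1≤c , c≤3 , ℕ.1∣ 2 , sym (ℕ.*-identityʳ c))
... | inj₂ c≡9 = inj₂ c≡9
divisor-p≡3 {suc (suc (suc (suc _)))} _ _ (s≤s (s≤s (s≤s ()))) (inj₂ refl) _

length-p≡3 : Prime 3 → ∀ f (O : PeriodicOrbit 3 f) → ProductOf≤And∣ 3 2 (length O) ⊎ length O ≡ 9
length-p≡3 pr f O = from (Cycle.return-p≡3 pr f O refl)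
  where
  from : (∃[ a ] ∃[ d ] 1 ≤ a × a ≤ 3 × (d ∣ 2 ⊎ d ≡ 3) ×
           iterate (eval f) (base O) (d ℕ.* a) ≈ₚ base O) →
         ProductOf≤And∣ 3 2 (length O) ⊎ length O ≡ 9
  from (a , d , 1≤a , a≤3 , d∈ , e) =
    divisor-p≡3 (positive O) 1≤a a≤3 d∈ (Cycle.length-∣ pr f O (d ℕ.* a) e)

length-≤p² : Prime p → 2 < p → ∀ f (O : PeriodicOrbit p f) → length O ≤ p ^ 2
length-≤p² {p} pr 2<p f O with ℕ.m≤n⇒m<n∨m≡n 2<p
... | inj₁ 3<p = from (length-p>3 pr 3<p f O)
  where
  from : ProductOf≤And∣ p (p ∸ 1) (length O) → length O ≤ p ^ 2
  from (a , d , _ , a≤p , d∣ , e) = ℕ.≤-trans (ℕ.≤-reflexive e) (ℕ.*-mono-≤ a≤p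
    (ℕ.≤-trans (ℕ.∣⇒≤ {{ℕ.>-nonZero (ℕ.m<n⇒0<n∸m (prime⇒1< pr))}} d∣)
      (ℕ.≤-trans (ℕ.m∸n≤m p 1) (ℕ.≤-reflexive (sym (ℕ.*-identityʳ p))))))
... | inj₂ refl = from (length-p≡3 pr f O)
  where
  from : ProductOf≤And∣ 3 2 (length O) ⊎ length O ≡ 9 → length O ≤ 9
  from (inj₁ (a , d , _ , a≤3 , d∣ , e)) = ℕ.≤-trans (ℕ.≤-reflexive e)
    (ℕ.≤-trans (ℕ.*-mono-≤ a≤3 (ℕ.∣⇒≤ d∣)) (ℕ.m≤m+n 6 3))
  from (inj₂ e) = ℕ.≤-reflexive e

-- Degrees and greatest common divisors of polynomial functions

-- Polynomials are represented by their functions ℤ → ℤ, which determine both the coefficients and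
-- the derivatives; Below n F says that F is a polynomial function of degree less than n.
data Below : ℕ → (ℤ → ℤ) → Set where
  vanishing : (∀ X → F X ≡ 0ℤ) → Below 0 F
  leading   : ∀ a → Below n (λ X → F X - a * X ^ℤ n) → Below (suc n) F

-- The coefficient `a` may be zero; statements about the exact degree add `a ≢ 0ℤ`.
record Leading (n : ℕ) (a : ℤ) (F : ℤ → ℤ) : Set where
  constructor mkLeading
  field rest : Below n (λ X → F X - a * X ^ℤ n)

open Leading public

leading⇒below : Leading n a F → Below (suc n) F
leading⇒below {a = a} (mkLeading B) = leading a B

below-cong : (∀ X → F X ≡ G X) → Below n F → Below n G
below-cong eq (vanishing h) = vanishing λ X → trans (sym (eq X)) (h X)
below-cong {n = suc n} eq (leading a B) =
  leading a (below-cong (λ X → cong (_- a * X ^ℤ n) (eq X)) B)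

leading-cong : (∀ X → F X ≡ G X) → Leading n a F → Leading n a G
leading-cong {n = n} {a} eq (mkLeading B) =
  mkLeading (below-cong (λ X → cong (_- a * X ^ℤ n) (eq X)) B)

below-0 : ∀ n → Below n (λ _ → 0ℤ)
below-0 zero    = vanishing λ _ → refl
below-0 (suc n) = leading 0ℤ (below-cong (λ X → lem (X ^ℤ n)) (below-0 n))
  where
  lem : ∀ y → 0ℤ ≡ 0ℤ - 0ℤ * y
  lem = solve-∀

below-+ : Below n F → Below n G → Below n (λ X → F X + G X)
below-+ (vanishing h) (vanishing k) = vanishing λ X → cong₂ _+_ (h X) (k X)
below-+ {suc n} {F} {G} (leading a B) (leading b C) =
  leading (a + b) (below-cong (λ X → lem (F X) (G X) a b (X ^ℤ n)) (below-+ B C))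
  where
  lem : ∀ f g a b y → (f - a * y) + (g - b * y) ≡ f + g - (a + b) * y
  lem = solve-∀

below-scale : ∀ c → Below n F → Below n (λ X → c * F X)
below-scale c (vanishing h) = vanishing λ X → trans (cong (λ y → c * y) (h X)) (ℤ.*-zeroʳ c)
below-scale {suc n} {F} c (leading a B) =
  leading (c * a) (below-cong (λ X → lem c (F X) a (X ^ℤ n)) (below-scale c B))
  where
  lem : ∀ c f a y → c * (f - a * y) ≡ c * f - c * a * y
  lem = solve-∀

below-suc : Below n F → Below (suc n) F
below-suc {n} {F} B = leading 0ℤ (below-cong (λ X → lem (F X) (X ^ℤ n)) B)
  where
  lem : ∀ f y → f ≡ f - 0ℤ * y
  lem = solve-∀

below-≤ : m ≤ n → Below m F → Below n F
below-≤ {F = F} m≤n B = go (ℕ.≤⇒≤′ m≤n)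
  where
  go : ∀ {n} → _ ℕ.≤′ n → Below n F
  go ℕ.≤′-refl     = B
  go (ℕ.≤′-step l) = below-suc (go l)

below-shift : Below n F → Below (suc n) (λ X → X * F X)
below-shift (vanishing h) = below-cong (λ X → sym (trans (cong (λ y → X * y) (h X)) (ℤ.*-zeroʳ X)))
  (below-0 1)
below-shift {suc n} {F} (leading a B) =
  leading a (below-cong (λ X → lem X (F X) a (X ^ℤ n)) (below-shift B))
  where
  lem : ∀ X f a y → X * (f - a * y) ≡ X * f - a * (X * y)
  lem = solve-∀

below-pow* : ∀ k → Below n F → Below (k ℕ.+ n) (λ X → X ^ℤ k * F X)
below-pow* {F = F} zero B = below-cong (λ X → sym (ℤ.*-identityˡ (F X))) B
below-pow* {F = F} (suc k) B = below-cong (λ X → sym (ℤ.*-assoc X (X ^ℤ k) (F X)))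
  (below-shift (below-pow* k B))

below-const : ∀ a → Below 1 (λ _ → a)
below-const a = leading a (vanishing λ _ → lem a)
  where
  lem : ∀ a → a - a * 1ℤ ≡ 0ℤ
  lem = solve-∀

below-* : Below m F → Below (suc n) G → Below (m ℕ.+ n) (λ X → F X * G X)
below-* {n = n} {G = G} (vanishing h) C =
  below-cong (λ X → sym (trans (cong (λ y → y * G X) (h X)) (ℤ.*-zeroˡ (G X)))) (below-0 n)
below-* {suc m} {F} {n} {G} (leading a B) C =
  below-cong (λ X → lem (F X) (G X) a (X ^ℤ m))
    (below-+ (below-suc (below-* B C))
      (below-≤ (ℕ.≤-reflexive (ℕ.+-suc m n)) (below-scale a (below-pow* m C))))
  where
  lem : ∀ f g a y → (f - a * y) * g + a * (y * g) ≡ f * g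
  lem = solve-∀

leading-* : Leading m a F → Leading n b G → Leading (m ℕ.+ n) (a * b) (λ X → F X * G X)
leading-* {m} {a} {F} {n} {b} {G} (mkLeading B) (mkLeading C) = mkLeading
  (below-cong (λ X → trans (lem (F X) (G X) a b (X ^ℤ m) (X ^ℤ n))
    (cong (λ y → F X * G X - a * b * y) (sym (ℤ.^-distribˡ-+-* X m n))))
    (below-+ (below-* B (leading b C)) (below-scale a (below-pow* m C))))
  where
  lem : ∀ f g a b y z → (f - a * y) * g + a * (y * (g - b * z)) ≡ f * g - a * b * (y * z)
  lem = solve-∀

Poly : (ℤ → ℤ) → Set
Poly F = ∃[ n ] Below n F

poly-+ : Poly F → Poly G → Poly (λ X → F X + G X)
poly-+ (m , B) (n , C) = m ℕ.+ n , below-+ (below-≤ (ℕ.m≤m+n m n) B) (below-≤ (ℕ.m≤n+m n m) C)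

poly-* : Poly F → Poly G → Poly (λ X → F X * G X)
poly-* (m , B) (n , C) = m ℕ.+ n , below-* B (below-suc C)

poly-scale : ∀ c → Poly F → Poly (λ X → c * F X)
poly-scale c (m , B) = m , below-scale c B

derivative-cong : (∀ X → F X ≡ G X) → (∀ X → F₁ X ≡ G₁ X) → Derivative F F₁ → Derivative G G₁
derivative-cong eq eq₁ D .expand X u with r , e ← expand D X u =
  r , trans (sym (eq (X + u))) (trans e (cong₂ (λ y z → y + z * u + r * (u * u)) (eq X) (eq₁ X)))

derivative-const : ∀ a → Derivative (λ _ → a) (λ _ → 0ℤ)
derivative-const a .expand X u = 0ℤ , lem a u
  where
  lem : ∀ a u → a ≡ a + 0ℤ * u + 0ℤ * (u * u)
  lem = solve-∀

derivative-+ : Derivative F F₁ → Derivative G G₁ → Derivative (λ X → F X + G X) (λ X → F₁ X + G₁ X)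
derivative-+ {F} {F₁} {G} {G₁} D E .expand X u with r , e ← expand D X u | s , e′ ← expand E X u =
  r + s , trans (cong₂ _+_ e e′) (lem (F X) (F₁ X) r (G X) (G₁ X) s u)
  where
  lem : ∀ a b r c d s u → (a + b * u + r * (u * u)) + (c + d * u + s * (u * u))
        ≡ a + c + (b + d) * u + (r + s) * (u * u)
  lem = solve-∀

derivative-* : Derivative F F₁ → Derivative G G₁ →
  Derivative (λ X → F X * G X) (λ X → F₁ X * G X + F X * G₁ X)
derivative-* {F} {F₁} {G} {G₁} D E .expand X u with r , e ← expand D X u | s , e′ ← expand E X u =
  F X * s + F₁ X * G₁ X + r * G X + u * (F₁ X * s + r * G₁ X + u * (r * s)) ,
  trans (cong₂ _*_ e e′) (lem (F X) (F₁ X) r (G X) (G₁ X) s u)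
  where
  lem : ∀ a b r c d s u → (a + b * u + r * (u * u)) * (c + d * u + s * (u * u))
        ≡ a * c + (b * c + a * d) * u + (a * s + b * d + r * c + u * (b * s + r * d + u * (r * s)))
          * (u * u)
  lem = solve-∀

derivative-scale : ∀ c → Derivative F F₁ → Derivative (λ X → c * F X) (λ X → c * F₁ X)
derivative-scale {F} {F₁} c D = derivative-cong (λ _ → refl) (λ X → lem (F X) c (F₁ X))
  (derivative-* (derivative-const c) D)
  where
  lem : ∀ f c g → 0ℤ * f + c * g ≡ c * g
  lem = solve-∀

derivative-pow : ∀ n → Derivative (λ X → X ^ℤ suc n) (λ X → + suc n * X ^ℤ n)
derivative-pow zero .expand X u = 0ℤ , lem X u
  where
  lem : ∀ X u → (X + u) * 1ℤ ≡ X * 1ℤ + 1ℤ * 1ℤ * u + 0ℤ * (u * u)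
  lem = solve-∀
derivative-pow (suc n) = derivative-cong (λ _ → refl) (λ X → lem X (X ^ℤ n) (+ suc n))
  (derivative-* (derivative smooth-id) (derivative-pow n))
  where
  lem : ∀ X y n → 1ℤ * (X * y) + X * (n * y) ≡ (1ℤ + n) * (X * y)
  lem = solve-∀

suc∣∣-∣ : ∀ d → + suc (abs d) ∣ℤ d → d ≡ 0ℤ
suc∣∣-∣ d h with abs d in e
... | zero  = ℤ.∣i∣≡0⇒i≡0 e
... | suc n = contradiction (ℕ.∣⇒≤ {{_}} (subst (suc (suc n) ∣_) e (∣⇒∣ᵤ h))) (ℕ.<-irrefl refl)

-- Choose `u` larger than the absolute value of the difference `δ`. The two expansions show that u²
-- divides `δ * u`, so `u` divides `δ`, which must then vanish.
derivative-unique : Derivative F F₁ → Derivative F G₁ → ∀ X → F₁ X ≡ G₁ X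
derivative-unique {F} {F₁} {G₁} D E X = from (expand D X u) (expand E X u)
  where
  δ u : ℤ
  δ = F₁ X - G₁ X
  u = + suc (abs δ)
  lem₁ : ∀ f a b r s u → (a - b) * u
         ≡ (s - r) * u * u + (f + a * u + r * (u * u) - (f + b * u + s * (u * u)))
  lem₁ = solve-∀
  lem₂ : ∀ a b → a + (b - b) ≡ a
  lem₂ = solve-∀
  lem₃ : ∀ a b → a ≡ a - b + b
  lem₃ = solve-∀
  from : ∃[ r ] F (X + u) ≡ F X + F₁ X * u + r * (u * u) →
         ∃[ s ] F (X + u) ≡ F X + G₁ X * u + s * (u * u) → F₁ X ≡ G₁ X
  from (r , e) (s , e′) = trans (lem₃ (F₁ X) (G₁ X))
    (trans (cong (_+ G₁ X) (suc∣∣-∣ δ (divides (s - r)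
    (ℤ.*-cancelʳ-≡ δ ((s - r) * u) u
      (trans (lem₁ (F X) (F₁ X) (G₁ X) r s u)
        (trans (cong₂ (λ y z → (s - r) * u * u + (y - z)) (sym e) (sym e′))
          (lem₂ ((s - r) * u * u) (F (X + u)))))))))
    (ℤ.+-identityˡ (G₁ X)))

derive : Below (suc n) F → ∃[ F₁ ] Derivative F F₁ × Below n F₁
derive-leading : Leading (suc n) a F → ∃[ F₁ ] Derivative F F₁ × Leading n (a * + suc n) F₁

derive {zero} {F} (leading a (vanishing h)) = (λ _ → 0ℤ) ,
  derivative-cong (λ X → sym (trans (lem (F X) a) (cong (_+ a) (h X)))) (λ _ → refl)
    (derivative-const (0ℤ + a)) , vanishing (λ _ → refl)
  where
  lem : ∀ f a → f ≡ f - a * 1ℤ + a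
  lem = solve-∀
derive {suc n} (leading a B) with F₁ , D , L ← derive-leading (mkLeading {a = a} B) =
  F₁ , D , leading⇒below L

derive-leading {n} {a} {F} (mkLeading B) with G₁ , D , C ← derive B =
  (λ X → G₁ X + a * (+ suc n * X ^ℤ n)) ,
  derivative-cong (λ X → lem₁ (F X) (a * X ^ℤ suc n)) (λ _ → refl)
    (derivative-+ D (derivative-scale a (derivative-pow n))) ,
  mkLeading (below-cong (λ X → lem₂ (G₁ X) a (+ suc n) (X ^ℤ n)) C)
  where
  lem₁ : ∀ f y → f - y + y ≡ f
  lem₁ = solve-∀
  lem₂ : ∀ g a s y → g ≡ g + a * (s * y) - a * s * y
  lem₂ = solve-∀

poly-derive : Poly F → ∃[ F₁ ] Derivative F F₁ × Poly F₁
poly-derive (n , B) with F₁ , D , C ← derive (below-suc B) = F₁ , D , n , C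

-- Differentiating `n` times leaves n! a, and the derivative of the zero function is zero. This is
-- why a function on ℤ determines its degree and leading coefficient.
leading-0 : ∀ n → Leading n a F → (∀ X → F X ≡ 0ℤ) → a ≡ 0ℤ
leading-0 {a} {F} zero (mkLeading (vanishing h)) z = trans (lem (F 0ℤ) a) (cong₂ _-_ (z 0ℤ) (h 0ℤ))
  where
  lem : ∀ f a → a ≡ f - (f - a * 1ℤ)
  lem = solve-∀
leading-0 {a} {F} (suc n) L z with F₁ , D , L₁ ← derive-leading L =
  [ id , (λ ()) ]′ (ℤ.i*j≡0⇒i≡0∨j≡0 a (leading-0 n L₁ (derivative-unique D
    (derivative-cong (λ X → sym (z X)) (λ _ → refl) (derivative-const 0ℤ)))))

leading-below-0 : Leading n a F → Below n F → a ≡ 0ℤ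
leading-below-0 {n} {a} {F} (mkLeading B) C = leading-0 n
  (mkLeading (below-cong (λ X → lem (F X) (a * X ^ℤ n)) (below-+ B (below-scale -1ℤ C))))
    (λ _ → refl)
  where
  lem : ∀ f y → f - y + -1ℤ * f ≡ 0ℤ - y
  lem = solve-∀

degree-unique : a ≢ 0ℤ → b ≢ 0ℤ → Leading m a F → Leading n b F → m ≡ n
degree-unique {m = m} {n = n} a≢0 b≢0 L M with ℕ.<-cmp m n
... | tri≈ _ m≡n _ = m≡n
... | tri< m<n _ _ = contradiction (leading-below-0 M (below-≤ m<n (leading⇒below L))) b≢0
... | tri> _ _ n<m = contradiction (leading-below-0 L (below-≤ n<m (leading⇒below M))) a≢0

leading? : Below n F → (∀ X → F X ≡ 0ℤ) ⊎ ∃[ k ] ∃[ a ] a ≢ 0ℤ × Leading k a F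
leading? (vanishing h) = inj₁ h
leading? {suc n} {F} (leading a B) with a ℤ.≟ 0ℤ
... | no a≢0   = inj₂ (n , a , a≢0 , mkLeading B)
... | yes refl = leading? (below-cong (λ X → lem (F X) (X ^ℤ n)) B)
  where
  lem : ∀ f y → f - 0ℤ * y ≡ f
  lem = solve-∀

-- The outcomes of Euclid's algorithm over ℤ without fractions. In `coprime` the Bézout cofactors
-- are chosen point by point, which suffices for divisibility of values. In `factor` the constants
-- `b` and `c` clear the denominators of the division over ℚ, and `d` has positive degree.
data Common (F G : ℤ → ℤ) : Set where
  coprime : ∀ D → D ≢ 0ℤ → (∀ X → ∃[ u ] ∃[ v ] u * F X + v * G X ≡ D) → Common F G
  factor  : ∀ {k a d q e b c} → a ≢ 0ℤ → Leading (suc k) a d → Poly q → Poly e → b ≢ 0ℤ → c ≢ 0ℤ →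
            (∀ X → b * F X ≡ d X * q X) → (∀ X → c * G X ≡ d X * e X) → Common F G
  zeros   : (∀ X → F X ≡ 0ℤ) → (∀ X → G X ≡ 0ℤ) → Common F G

common-swap : Common F G → Common G F
common-swap {F} {G} (coprime D D≢0 bez) = coprime D D≢0 λ X → swap X (bez X)
  where
  swap : ∀ X → (∃[ u ] ∃[ v ] u * F X + v * G X ≡ D) → ∃[ u ] ∃[ v ] u * G X + v * F X ≡ D
  swap X (u , v , e) = v , u , trans (ℤ.+-comm (v * G X) (u * F X)) e
common-swap (factor a≢0 L Q E b≢0 c≢0 e e′) = factor a≢0 L E Q c≢0 b≢0 e′ e
common-swap (zeros h k) = zeros k h

*-≢0 : a ≢ 0ℤ → b ≢ 0ℤ → a * b ≢ 0ℤ
*-≢0 {a} a≢0 b≢0 e = [ a≢0 , b≢0 ]′ (ℤ.i*j≡0⇒i≡0∨j≡0 a e)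

-- One step of pseudo-division: `b * F` is recovered from `b * F - H * G` and `G`, so a Bézout
-- relation carries over, and so does a common factor up to nonzero constants.
common-eliminate : b ≢ 0ℤ → Poly H → Common (λ X → b * F X - H X * G X) G → Common F G
common-eliminate {b} {H} {F} {G} b≢0 PH (coprime D D≢0 bez) = coprime D D≢0 λ X → go X (bez X)
  where
  lem : ∀ u v b f h g → u * b * f + (v - u * h) * g ≡ u * (b * f - h * g) + v * g
  lem = solve-∀
  go : ∀ X → (∃[ u ] ∃[ v ] u * (b * F X - H X * G X) + v * G X ≡ D) →
       ∃[ u ] ∃[ v ] u * F X + v * G X ≡ D
  go X (u , v , e) = u * b , v - u * H X , trans (lem u v b (F X) (H X) (G X)) e
common-eliminate {b} {H} {F} {G} b≢0 PH
  (factor {d = d} {q} {e} {c₁} {c₂} a≢0 L Q E c₁≢0 c₂≢0 eq₁ eq₂) =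
  factor {q = λ X → c₂ * q X + c₁ * (H X * e X)} a≢0 L
    (poly-+ (poly-scale c₂ Q) (poly-scale c₁ (poly-* PH E))) E (*-≢0 (*-≢0 c₁≢0 c₂≢0) b≢0) c₂≢0
    (λ X → trans (lem₁ c₁ c₂ b (F X) (H X) (G X))
      (trans (cong₂ (λ y z → c₂ * y + c₁ * H X * z) (eq₁ X) (eq₂ X))
        (lem₂ (d X) (q X) (e X) c₁ c₂ (H X)))) eq₂
  where
  lem₁ : ∀ c₁ c₂ b f h g → c₁ * c₂ * b * f ≡ c₂ * (c₁ * (b * f - h * g)) + c₁ * h * (c₂ * g)
  lem₁ = solve-∀
  lem₂ : ∀ d q e c₁ c₂ h → c₂ * (d * q) + c₁ * h * (d * e) ≡ d * (c₂ * q + c₁ * (h * e))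
  lem₂ = solve-∀
common-eliminate {b} {H} {F} {G} b≢0 PH (zeros h k) = zeros
  (λ X → [ (λ z → contradiction z b≢0) , id ]′
    (ℤ.i*j≡0⇒i≡0∨j≡0 b (trans (lem b (F X) (H X) (G X))
      (cong₂ (λ y z → y + H X * z) (h X) (k X) ⟨ trans ⟩ trans (ℤ.+-identityˡ (H X * 0ℤ))
        (ℤ.*-zeroʳ (H X))))))
  k
  where
  lem : ∀ b f h g → b * f ≡ b * f - h * g + h * g
  lem = solve-∀

eliminate-leading : n ≤ m → Leading m a F → Leading n b G →
  Below m (λ X → b * F X - a * X ^ℤ (m ∸ n) * G X)
eliminate-leading {n} {m} {a} {F} {b} {G} n≤m (mkLeading B) (mkLeading C) =
  below-cong (λ X → trans
    (cong (λ y → b * (F X - a * y) + - a * (X ^ℤ (m ∸ n) * (G X - b * X ^ℤ n))) (X^m X))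
      (lem (F X) (G X) a b (X ^ℤ (m ∸ n)) (X ^ℤ n)))
    (below-+ (below-scale b B)
      (below-≤ (ℕ.≤-reflexive (ℕ.m∸n+n≡m n≤m)) (below-scale (- a) (below-pow* (m ∸ n) C))))
  where
  X^m : ∀ X → X ^ℤ m ≡ X ^ℤ (m ∸ n) * X ^ℤ n
  X^m X = trans (cong (X ^ℤ_) (sym (ℕ.m∸n+n≡m n≤m))) (ℤ.^-distribˡ-+-* X (m ∸ n) n)
  lem : ∀ f g a b y z → b * (f - a * (y * z)) + - a * (y * (g - b * z)) ≡ b * f - a * y * g
  lem = solve-∀

poly-monomial : ∀ a k → Poly (λ X → a * X ^ℤ k)
poly-monomial a k = _ , below-cong (λ X → cong (λ y → a * y) (ℤ.*-identityʳ (X ^ℤ k)))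
  (below-scale a (below-pow* k (below-const 1ℤ)))

-- The gcd with zero is `F` itself: a nonzero constant is a Bézout relation, and in positive degree
-- `F` is the common factor, with quotients 1 and 0.
common-0 : a ≢ 0ℤ → Leading n a F → (∀ X → G X ≡ 0ℤ) → Common F G
common-0 {a} {zero} {F} {G} a≢0 (mkLeading (vanishing h)) z = coprime a a≢0 λ X → 1ℤ , 0ℤ ,
  trans (lem (F X) (G X) a) (cong (_+ a) (h X) ⟨ trans ⟩ ℤ.+-identityˡ a)
  where
  lem : ∀ f g a → 1ℤ * f + 0ℤ * g ≡ f - a * 1ℤ + a
  lem = solve-∀
common-0 {a} {suc n} {F} {G} a≢0 L z = factor {b = 1ℤ} {1ℤ} a≢0 L (1 , below-const 1ℤ)
  (0 , vanishing (λ _ → refl)) (λ ()) (λ ())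
  (λ X → ℤ.*-comm 1ℤ (F X)) (λ X → trans (cong (λ y → 1ℤ * y) (z X)) (sym (ℤ.*-zeroʳ (F X))))

-- Cross-multiplication by the leading coefficients replaces division; every step lowers one of the
-- two degree bounds.
common : ∀ m n → Below m F → Below n G → Common F G
common {F} {G} zero n (vanishing h) C with leading? C
... | inj₁ k = zeros h k
... | inj₂ (_ , _ , b≢0 , L) = common-swap (common-0 b≢0 L h)
common m@(suc _) zero B (vanishing k) with leading? B
... | inj₁ h = zeros h k
... | inj₂ (_ , _ , a≢0 , L) = common-0 a≢0 L k
common {F} {G} (suc m) (suc n) (leading a B) (leading b C) with a ℤ.≟ 0ℤ | b ℤ.≟ 0ℤ
... | yes refl | _ = common m (suc n) (below-cong (λ X → lem (F X) (X ^ℤ m)) B) (leading b C)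
  where
  lem : ∀ f y → f - 0ℤ * y ≡ f
  lem = solve-∀
... | no _ | yes refl = common (suc m) n (leading a B) (below-cong (λ X → lem (G X) (X ^ℤ n)) C)
  where
  lem : ∀ f y → f - 0ℤ * y ≡ f
  lem = solve-∀
... | no a≢0 | no b≢0 with ℕ.≤-total n m
...   | inj₁ n≤m = common-eliminate b≢0 (poly-monomial a (m ∸ n))
        (common m (suc n) (eliminate-leading n≤m (mkLeading {a = a} B) (mkLeading {a = b} C))
          (leading b C))
...   | inj₂ m≤n = common-swap (common-eliminate a≢0 (poly-monomial b (n ∸ m))
        (common-swap (common (suc m) n (leading a B)
          (eliminate-leading m≤n (mkLeading {a = b} C) (mkLeading {a = a} B)))))

-- Roots in ℤₚ

record Root {p : ℕ} (x : ℤₚ p) (F : ℤ → ℤ) : Set where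
  constructor mkRoot
  field root-∣ : ∀ n → + (p ^ n) ∣ℤ F (residue x n)

open Root public

-- Multiplicity of a zero in ℤₚ

module Vanishing (pr : Prime p) (x : ℤₚ p) where

  root-cong : (∀ X → F X ≡ G X) → Root x F → Root x G
  root-cong eq (mkRoot h) = mkRoot λ n → ∣-resp (eq (residue x n)) (h n)

  root-+ : Root x F → Root x G → Root x (λ X → F X + G X)
  root-+ (mkRoot h) (mkRoot k) = mkRoot λ n → ∣m∣n⇒∣m+n (h n) (k n)

  root-*ˡ : Root x F → Root x (λ X → F X * G X)
  root-*ˡ {G = G} (mkRoot h) = mkRoot λ n → ∣m⇒∣m*n (G (residue x n)) (h n)

  -- Nonvanishing of `G` is given by a precision `s` at which it is visible; reading the product `s`
  -- digits deeper makes up for the factor `G`.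
  root-cancel : Derivative F F₁ → Derivative G G₁ → ∀ s → ¬ + (p ^ s) ∣ℤ G (residue x s) →
    Root x (λ X → F X * G X) → Root x F
  root-cancel {F} {F₁} {G} {G₁} D E s G≢0 (mkRoot h) = mkRoot λ n →
    ≡mod⇒∣ (derivative-≡mod D (residue-≤ x (ℕ.m≤m+n n s)))
      (pow-∣-split pr s n (F (residue x (n ℕ.+ s))) (G (residue x (n ℕ.+ s))) (h (n ℕ.+ s))
        λ k → G≢0 (≡mod⇒∣ (derivative-≡mod E (residue-≤ x (ℕ.m≤n+m s n))) k))

  constant-root : ∀ a → Root x (λ _ → a) → a ≡ 0ℤ
  constant-root a h with a ℤ.≟ 0ℤ
  ... | yes a≡0 = a≡0
  ... | no  a≢0 = contradiction
    (ℕ.∣⇒≤ {{ℕ.≢-nonZero (λ e → a≢0 (ℤ.∣i∣≡0⇒i≡0 e))}} (∣⇒∣ᵤ (root-∣ h (abs a))))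
    (ℕ.<⇒≱ (n<p^n (prime⇒1< pr) (abs a)))

  -- Zero of multiplicity at least `m`: the first `m` of F, F′, F″, ... vanish at `x`. Derivatives
  -- avoid division by X - x, whose coefficients are not integers.
  Flat : ℕ → (ℤ → ℤ) → Set
  Flat zero    F = ⊤
  Flat (suc m) F = Root x F × ∃[ F₁ ] Derivative F F₁ × Poly F₁ × Flat m F₁

  flat-cong : ∀ m → (∀ X → F X ≡ G X) → Flat m F → Flat m G
  flat-cong zero    eq _ = tt
  flat-cong (suc m) eq (h , F₁ , D , P , Φ) =
    root-cong eq h , F₁ , derivative-cong eq (λ _ → refl) D , P , Φ

  flat-derivative : ∀ m → Derivative F F₁ → Flat (suc m) F → Flat m F₁
  flat-derivative m D (_ , G₁ , E , P , Φ) = flat-cong m (derivative-unique E D) Φ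

  flat-pred : ∀ m → Flat (suc m) F → Flat m F
  flat-pred zero    _ = tt
  flat-pred (suc m) (h , F₁ , D , P , Φ) = h , F₁ , D , P , flat-pred m Φ

  flat-+ : ∀ m → Flat m F → Flat m G → Flat m (λ X → F X + G X)
  flat-+ zero    _ _ = tt
  flat-+ (suc m) (h , F₁ , D , P , Φ) (k , G₁ , E , Q , Ψ) =
    root-+ h k , _ , derivative-+ D E , poly-+ P Q , flat-+ m Φ Ψ

  flat-*ˡ : ∀ m → Poly F → Poly G → Flat m F → Flat m (λ X → F X * G X)
  flat-*ˡ zero    _ _ _ = tt
  flat-*ˡ {F} {G} (suc m) P Q Φ@(h , F₁ , D , P₁ , Φ₁) with G₁ , E , Q₁ ← poly-derive Q =
    root-*ˡ {G = G} h , _ , derivative-* D E , poly-+ (poly-* P₁ Q) (poly-* P Q₁) ,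
    flat-+ m (flat-*ˡ m P₁ Q Φ₁) (flat-*ˡ m P Q₁ (flat-pred m Φ))

  flat-scale : ∀ m c → Poly F → Flat m F → Flat m (λ X → c * F X)
  flat-scale {F} m c P Φ = flat-cong m (λ X → ℤ.*-comm (F X) c) (flat-*ˡ m P (1 , below-const c) Φ)

  -- By Leibniz, F′ G = (F G)′ - F G′, where the last term is as flat as `F`. So the extra order of
  -- the product passes to F′ by induction, and with it to `F`.
  flat-cancel : ∀ m → Poly F → Poly G → ∀ s → ¬ + (p ^ s) ∣ℤ G (residue x s) →
    Flat m F → Flat (suc m) (λ X → F X * G X) → Flat (suc m) F
  flat-cancel zero P Q s G≢0 _ (h , _)
    with F₁ , D , P₁ ← poly-derive P | G₁ , E , _ ← poly-derive Q =
    root-cancel D E s G≢0 h , F₁ , D , P₁ , tt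
  flat-cancel {F} {G} (suc m) P Q s G≢0 Φ@(h , F₁ , D , P₁ , Φ₁) Ψ
    with G₁ , E , Q₁ ← poly-derive Q =
    h , F₁ , D , P₁ , flat-cancel m P₁ Q s G≢0 Φ₁
      (flat-cong (suc m) (λ X → lem (F₁ X * G X) (F X * G₁ X))
        (flat-+ (suc m) (flat-derivative (suc m) (derivative-* D E) Ψ)
          (flat-scale (suc m) -1ℤ (poly-* P Q₁) (flat-*ˡ (suc m) P Q₁ Φ))))
    where
    lem : ∀ a b → a + b + -1ℤ * b ≡ a
    lem = solve-∀

  flat-cancel-const : ∀ m c → c ≢ 0ℤ → Poly F → Flat m (λ X → c * F X) → Flat m F
  flat-cancel-const zero c c≢0 P _ = tt
  flat-cancel-const {F} (suc m) c c≢0 P (h , Ψ) with F₁ , D , P₁ ← poly-derive P =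
    root-cancel D (derivative-const c) (abs c) p^∤c (root-cong (λ X → ℤ.*-comm c (F X)) h) ,
    F₁ , D , P₁ ,
    flat-cancel-const m c c≢0 P₁ (flat-derivative m (derivative-scale c D) (h , Ψ))
    where
    p^∤c : ¬ + (p ^ abs c) ∣ℤ c
    p^∤c k = ℕ.<⇒≱ (n<p^n (prime⇒1< pr) (abs c))
      (ℕ.∣⇒≤ {{ℕ.≢-nonZero (λ e → c≢0 (ℤ.∣i∣≡0⇒i≡0 e))}} (∣⇒∣ᵤ k))

  -- After `k` derivatives only k! a is left, an integer divisible by every power of `p`.
  flat-leading-0 : ∀ k → Leading k a F → Flat (suc k) F → a ≡ 0ℤ
  flat-leading-0 {a} {F} zero (mkLeading (vanishing h)) (r , _) =
    constant-root a (root-cong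
      (λ X → trans (lem (F X) a) (cong (_+ a) (h X) ⟨ trans ⟩ ℤ.+-identityˡ a)) r)
    where
    lem : ∀ f a → f ≡ f - a * 1ℤ + a
    lem = solve-∀
  flat-leading-0 {a} (suc k) L Φ with F₁ , D , L₁ ← derive-leading L =
    [ id , (λ ()) ]′ (ℤ.i*j≡0⇒i≡0∨j≡0 a (flat-leading-0 k L₁ (flat-derivative (suc k) D Φ)))

  -- Suppose q(x) is nonzero at some precision. If `d` vanishes to order `m`, so does F′, by c F′ =
  -- d e; as F(x) = 0, `F` and hence d q vanish to order m + 1, and cancelling `q` gives order m + 1
  -- for `d`. Thus `d` vanishes to every order, against its degree.
  root-quotient : ∀ {d q e} → a ≢ 0ℤ → Leading k a d → Poly q → Poly e → b ≢ 0ℤ → c ≢ 0ℤ →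
    Poly F → Derivative F F₁ → (∀ X → b * F X ≡ d X * q X) → (∀ X → c * F₁ X ≡ d X * e X) →
    Root x F → Root x q
  root-quotient {k = k} {b = b} {c = c} {F} {F₁} {d} {q} {e} a≢0 L Q E b≢0 c≢0 P D eq eq₁ h =
    mkRoot λ s →
    decidable-stable (+ (p ^ s) ∣? q (residue x s)) λ q≢0 →
      a≢0 (flat-leading-0 k L (flat s q≢0 (suc k)))
    where
    Pd : Poly d
    Pd = suc k , leading⇒below L
    P₁ : Poly F₁
    P₁ with G₁ , E′ , n , B ← poly-derive P = n , below-cong (derivative-unique E′ D) B
    flat : ∀ s → ¬ + (p ^ s) ∣ℤ q (residue x s) → ∀ m → Flat m d
    flat s q≢0 zero    = tt
    flat s q≢0 (suc m) = flat-cancel m Pd Q s q≢0 (flat s q≢0 m)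
      (flat-cong (suc m) eq (flat-scale (suc m) b P (h , F₁ , D , P₁ ,
        flat-cancel-const m c c≢0 P₁
          (flat-cong m (λ X → sym (eq₁ X)) (flat-*ˡ m Pd E (flat s q≢0 m))))))

-- Locating roots when `F` and its derivative satisfy a Bézout relation

private
  keepIfCoherent : ∀ m a z → ∃[ b ] b ≡ z ⟨mod m ⟩ × (a ≡ z ⟨mod m ⟩ → b ≡ a)
  keepIfCoherent m a z with + m ∣? a - z
  ... | yes h = a , mod h , λ _ → refl
  ... | no ¬h = z , ≡mod-refl , λ { (mod h) → contradiction h ¬h }

-- A term incompatible with the previous choice is replaced by that choice, so any sequence yields
-- an element of ℤₚ; one that agrees with some `y` is never altered.
coherentPrefix : (ℕ → ℤ) → ℤₚ p
coherentPrefix {p} s = record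
  { residue  = go
  ; coherent = λ n → unmod (proj₁ (proj₂ (keepIfCoherent (p ^ n) (s (suc n)) (go n))))
  }
  where
  go : ℕ → ℤ
  go zero    = s 0
  go (suc n) = proj₁ (keepIfCoherent (p ^ n) (s (suc n)) (go n))

coherentPrefix-≈ : ∀ s (y : ℤₚ p) → (∀ n → s n ≡ residue y n ⟨mod p ^ n ⟩) → y ≈ₚ coherentPrefix s
coherentPrefix-≈ {p} s y h = mk≈ λ n → unmod (≡mod-sym (go n))
  where
  z : ℤₚ p
  z = coherentPrefix s
  go : ∀ n → residue z n ≡ residue y n ⟨mod p ^ n ⟩
  go zero    = h 0
  go (suc n) = ≡mod-trans
    (≡mod-reflexive (proj₂ (proj₂ (keepIfCoherent (p ^ n) (s (suc n)) (residue z n)))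
    (≡mod-trans (≡mod-∣ (pow-mono-∣ (ℕ.n≤1+n n)) (h (suc n)))
      (≡mod-trans (mod (coherent y n)) (≡mod-sym (go n)))))) (h (suc n))

-- Existence is never passed to the caller: if nothing is found, the default `0ℤ` meets the
-- conclusion vacuously.
search : {P : ℤ → Set} → (∀ X → Dec (P X)) → ∀ N → ∃[ X ] (∀ i → i < N → P (+ i) → P X)
search {P} P? N with Fin.any? {n = N} (λ i → P? (+ toℕ i))
... | yes (i , h) = + toℕ i , λ _ _ _ → h
... | no ¬h = 0ℤ , λ i i<N h →
  contradiction (fromℕ< i<N , subst (λ j → P (+ j)) (sym (Fin.toℕ-fromℕ< i<N)) h) ¬h

module Separated (pr : Prime p) (D : Derivative F F₁) {R : ℤ} (R≢0 : R ≢ 0ℤ)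
  (bezout : ∀ X → ∃[ u ] ∃[ v ] u * F X + v * F₁ X ≡ R) where

  private
    instance _ = prime⇒nonZero pr

    κ : ℕ
    κ = abs R

    p^κ∤R : ¬ + (p ^ κ) ∣ℤ R
    p^κ∤R k = ℕ.<⇒≱ (n<p^n (prime⇒1< pr) κ)
      (ℕ.∣⇒≤ {{ℕ.≢-nonZero (λ e → R≢0 (ℤ.∣i∣≡0⇒i≡0 e))}} (∣⇒∣ᵤ k))

    -- F(X) - F(Y) = (X - Y)(F₁(Y) + r (X - Y)). If p^κ divided the second factor, it would divide
    -- F₁(Y), and together with F(Y) also `R`. So at most κ digits are lost, which the precision
    -- `n + κ` provides.
    separation : ∀ n X Y → + (p ^ (n ℕ.+ κ)) ∣ℤ F X → + (p ^ (n ℕ.+ κ)) ∣ℤ F Y →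
      X ≡ Y ⟨mod p ^ κ ⟩ → X ≡ Y ⟨mod p ^ n ⟩
    separation n X Y FX FY X≡Y = from (expand D Y (X - Y))
      where
      lem₁ : ∀ X Y → Y + (X - Y) ≡ X
      lem₁ = solve-∀
      lem₂ : ∀ f f₁ r u → f + f₁ * u + r * (u * u) - f ≡ u * (f₁ + r * u)
      lem₂ = solve-∀
      lem₃ : ∀ u v f f₁ w → u * f + v * (f₁ + w) + v * - w ≡ u * f + v * f₁
      lem₃ = solve-∀
      from : ∃[ r ] F (Y + (X - Y)) ≡ F Y + F₁ Y * (X - Y) + r * ((X - Y) * (X - Y)) →
        X ≡ Y ⟨mod p ^ n ⟩
      from (r , e) = mod (pow-∣-split pr κ n (X - Y) (F₁ Y + r * (X - Y))
        (∣-resp (trans (cong (λ y → y - F Y) (trans (cong F (sym (lem₁ X Y))) e))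
          (lem₂ (F Y) (F₁ Y) r (X - Y)))
          (∣m∣n⇒∣m+n FX (∣m⇒∣-m FY)))
        λ k → p^κ∤R (bez k (bezout Y)))
        where
        bez : + (p ^ κ) ∣ℤ F₁ Y + r * (X - Y) → (∃[ u ] ∃[ v ] u * F Y + v * F₁ Y ≡ R) →
          + (p ^ κ) ∣ℤ R
        bez k (u , v , e) = ∣-resp (trans (lem₃ u v (F Y) (F₁ Y) (r * (X - Y))) e)
          (∣m∣n⇒∣m+n (∣m∣n⇒∣m+n (∣n⇒∣m*n u (∣-trans (pow-mono-∣ (ℕ.m≤n+m κ n)) FY)) (∣n⇒∣m*n v k))
            (∣n⇒∣m*n v (∣m⇒∣-m (∣n⇒∣m*n r (unmod X≡Y)))))

    Approximates : ℤ → ℕ → ℤ → Set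
    Approximates r n X = + (p ^ (n ℕ.+ κ)) ∣ℤ F X × X ≡ r ⟨mod p ^ κ ⟩

    found : ∀ r n → ∃[ X ] (∀ i → i < p ^ (n ℕ.+ κ) → Approximates r n (+ i) → Approximates r n X)
    found r n = search (λ X → (+ (p ^ (n ℕ.+ κ)) ∣? F X) ×-dec ≡mod? X r (p ^ κ)) (p ^ (n ℕ.+ κ))

    -- A candidate need not be a root; it only has to agree with every root in its residue class
    -- modulo p^κ, so the existence half of Hensel's lemma is not needed.
    candidate : Fin (p ^ κ) → ℤₚ p
    candidate i = coherentPrefix λ n → proj₁ (found (+ toℕ i) n)

    candidate-≈ : ∀ y → Root y F → ∀ i → + toℕ i ≡ residue y κ ⟨mod p ^ κ ⟩ → y ≈ₚ candidate i
    candidate-≈ y h i y≡i = coherentPrefix-≈ _ y at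
      where
      at : ∀ n → proj₁ (found (+ toℕ i) n) ≡ residue y n ⟨mod p ^ n ⟩
      at n = ≡mod-trans (separation n X Y (proj₁ ok) (root-∣ h N)
        (≡mod-trans (proj₂ ok) (≡mod-sym Y≡i)))
               (residue-≤ y (ℕ.m≤m+n n κ))
        where
        N : ℕ
        N = n ℕ.+ κ
        instance _ = ℕ.m^n≢0 p N
        X Y : ℤ
        X = proj₁ (found (+ toℕ i) n)
        Y = residue y N
        Y≡i : Y ≡ + toℕ i ⟨mod p ^ κ ⟩
        Y≡i = ≡mod-trans (residue-≤ y (ℕ.m≤n+m κ n)) (≡mod-sym y≡i)
        Y% : + (Y ℤ.%ℕ p ^ N) ≡ Y ⟨mod p ^ N ⟩
        Y% = ≡mod-%ℕ Y (p ^ N)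
        -- The root itself, reduced modulo `p ^ N`, lies in the searched range, so the search has
        -- succeeded.
        ok : Approximates (+ toℕ i) n X
        ok = proj₂ (found (+ toℕ i) n) (Y ℤ.%ℕ p ^ N) (ℤ.n%ℕd<d Y (p ^ N))
          (≡mod⇒∣ (≡mod-sym (derivative-≡mod D Y%)) (root-∣ h N) , ≡mod-trans
            (≡mod-∣ (pow-mono-∣ (ℕ.m≤n+m κ n)) Y%) Y≡i)

  finitely-many : FinitelyMany {p} (λ y → Root y F)
  finitely-many = tabulate candidate , λ y h → tabulate⁺ (index y) (candidate-≈ y h (index y)
    (≡mod-trans (≡mod-reflexive (cong +_ (Fin.toℕ-fromℕ< (ℤ.n%ℕd<d (residue y κ) (p ^ κ)))))
      (≡mod-%ℕ (residue y κ) (p ^ κ))))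
    where
    instance _ = ℕ.m^n≢0 p κ
    index : ℤₚ p → Fin (p ^ κ)
    index y = fromℕ< (ℤ.n%ℕd<d (residue y κ) (p ^ κ))

finitely-many-roots : Prime p → ∀ n → Acc _<_ n → a ≢ 0ℤ → Leading n a F →
  FinitelyMany {p} (λ y → Root y F)
finitely-many-roots {p} {a} {F} pr zero _ a≢0 L = [] , λ y h →
  contradiction (Vanishing.flat-leading-0 pr y 0 L
    (h , proj₁ F′ , proj₁ (proj₂ F′) , proj₂ (proj₂ F′) , tt)) a≢0
  where
  F′ : ∃[ F₁ ] Derivative F F₁ × Poly F₁
  F′ = poly-derive (1 , leading⇒below L)
finitely-many-roots {p} {a} {F} pr (suc n) (acc rs) a≢0 L = from (derive (leading⇒below L))
  where
  from : ∃[ F₁ ] Derivative F F₁ × Below (suc n) F₁ → FinitelyMany {p} (λ y → Root y F)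
  from (F₁ , D , B₁) with common (suc (suc n)) (suc n) (leading⇒below L) B₁
  ... | coprime R R≢0 bezout = Separated.finitely-many pr D R≢0 bezout
  ... | zeros h _ = contradiction (leading-0 (suc n) L h) a≢0
  ... | factor {k} {a′} {d} {q} {e} {b} {c} a′≢0 M (s , Q) E b≢0 c≢0 eq eq₁ with leading? Q
  ...   | inj₁ h = contradiction
          (leading-0 (suc n) L λ X → [ (λ z → contradiction z b≢0) , id ]′ (ℤ.i*j≡0⇒i≡0∨j≡0 b
            (trans (eq X) (trans (cong (λ y → d X * y) (h X)) (ℤ.*-zeroʳ (d X)))))) a≢0
  ...   | inj₂ (l , b′ , b′≢0 , K) = proj₁ IH , λ y h → proj₂ IH y
          (Vanishing.root-quotient pr y a′≢0 M (s , Q) E b≢0 c≢0 (suc (suc n) , leading⇒below L) D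
            eq eq₁ h)
    where
    bF : Leading (suc n) (b * a) (λ X → b * F X)
    bF = mkLeading (below-cong (λ X → lem b (F X) a (X ^ℤ suc n)) (below-scale b (rest L)))
      where
      lem : ∀ b f a y → b * (f - a * y) ≡ b * f - b * a * y
      lem = solve-∀
    -- Degrees add in b F = d q, and `d` has degree at least one; hence the induction on the degree
    -- applies to `q`.
    degree : suc n ≡ suc k ℕ.+ l
    degree = degree-unique (*-≢0 b≢0 a≢0) (*-≢0 a′≢0 b′≢0) bF
      (leading-cong (λ X → sym (eq X)) (leading-* M K))
    IH : FinitelyMany {p} (λ y → Root y q)
    IH = finitely-many-roots pr l
      (rs (s≤s (subst (l ≤_) (sym (ℕ.suc-injective degree)) (ℕ.m≤n+m l k)))) b′≢0 K

-- Degrees of iterates and finiteness of the periodic points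

evalℤ-zero : ∀ f → (∀ i → coeff f i ≡ 0ℤ) → ∀ X → evalℤ f X ≡ 0ℤ
evalℤ-zero []      h X = refl
evalℤ-zero (a ∷ f) h X = trans (cong₂ (λ y z → y + X * z) (h 0) (evalℤ-zero f (h ∘ suc) X))
  (trans (ℤ.+-identityˡ (X * 0ℤ)) (ℤ.*-zeroʳ X))

leading-evalℤ : ∀ f n → (∀ i → n < i → coeff f i ≡ 0ℤ) → Leading n (coeff f n) (evalℤ f)
leading-evalℤ [] n h = mkLeading (below-cong (λ X → lem (X ^ℤ n)) (below-0 n))
  where
  lem : ∀ y → 0ℤ ≡ 0ℤ - 0ℤ * y
  lem = solve-∀
leading-evalℤ (a ∷ f) zero h =
  mkLeading (vanishing λ X →
    trans (cong (λ y → a + X * y - a * 1ℤ) (evalℤ-zero f (λ i → h (suc i) (s≤s z≤n)) X)) (lem a X))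
  where
  lem : ∀ a X → a + X * 0ℤ - a * 1ℤ ≡ 0ℤ
  lem = solve-∀
leading-evalℤ (a ∷ f) (suc n) h =
  mkLeading (below-cong (λ X → lem a X (evalℤ f X) (coeff f n) (X ^ℤ n))
  (below-+ (below-≤ (s≤s z≤n) (below-const a))
    (below-shift (rest (leading-evalℤ f n (λ i n<i → h (suc i) (s≤s n<i)))))))
  where
  lem : ∀ a X y c z → a + X * (y - c * z) ≡ a + X * y - c * (X * z)
  lem = solve-∀

leadingCoeff : ∀ f → (∀ i → coeff f i ≡ 0ℤ) ⊎ ∃[ n ] coeff f n ≢ 0ℤ × (∀ i → n < i → coeff f i ≡ 0ℤ)
leadingCoeff [] = inj₁ λ _ → refl
leadingCoeff (a ∷ f) with leadingCoeff f
... | inj₂ (n , c≢0 , h) = inj₂ (suc n , c≢0 , λ { (suc i) (s≤s n<i) → h i n<i })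
... | inj₁ h with a ℤ.≟ 0ℤ
...   | yes a≡0 = inj₁ λ { zero → a≡0 ; (suc i) → h i }
...   | no  a≢0 = inj₂ (0 , a≢0 , λ { (suc i) _ → h i })

^-≢0 : a ≢ 0ℤ → ∀ n → a ^ℤ n ≢ 0ℤ
^-≢0 a≢0 zero    = λ ()
^-≢0 a≢0 (suc n) = *-≢0 a≢0 (^-≢0 a≢0 n)

leading-^ : ∀ m → Leading n b H → Leading (m ℕ.* n) (b ^ℤ m) (λ X → H X ^ℤ m)
leading-^ zero    L = mkLeading (vanishing λ _ → refl)
leading-^ (suc m) L = leading-* L (leading-^ m L)

below-∘ : 1 ≤ n → Below m F → Leading n b H → Below (m ℕ.* n) (λ X → F (H X))
below-∘ 1≤n (vanishing h) L = vanishing λ X → h _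
below-∘ {n} {suc m} {F} {b} {H} 1≤n (leading a B) L =
  below-cong (λ X → lem (F (H X)) (a * H X ^ℤ m))
    (below-+ (below-≤ (ℕ.m≤n+m (m ℕ.* n) n) (below-∘ 1≤n B L))
      (below-scale a (below-≤ (ℕ.+-monoˡ-≤ (m ℕ.* n) 1≤n) (leading⇒below (leading-^ m L)))))
  where
  lem : ∀ f y → f - y + y ≡ f
  lem = solve-∀

leading-∘ : 1 ≤ n → Leading m a F → Leading n b H → Leading (m ℕ.* n) (a * b ^ℤ m) (λ X → F (H X))
leading-∘ {n} {m} {a} {F} {b} {H} 1≤n (mkLeading B) L = mkLeading
  (below-cong (λ X → lem (F (H X)) a (H X ^ℤ m) (b ^ℤ m) (X ^ℤ (m ℕ.* n)))
    (below-+ (below-∘ 1≤n B L) (below-scale a (rest (leading-^ m L)))))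
  where
  lem : ∀ f a h c y → f - a * h + a * (h - c * y) ≡ f - a * c * y
  lem = solve-∀

leading-iterate : 2 ≤ n → a ≢ 0ℤ → Leading n a F → ∀ c →
  ∃[ N ] ∃[ b ] 2 ≤ N × b ≢ 0ℤ × Leading N b (λ X → iterate F X (suc c))
leading-iterate {n} {a} 2≤n a≢0 L zero = n , a , 2≤n , a≢0 , L
leading-iterate {n} {a} 2≤n a≢0 L (suc c) with N , b , 2≤N , b≢0 , M ← leading-iterate 2≤n a≢0 L c =
  N ℕ.* n , b * a ^ℤ N , ℕ.≤-trans 2≤n (ℕ.m≤n*m n N {{ℕ.>-nonZero (ℕ.≤-trans (s≤s z≤n) 2≤N)}}) ,
  *-≢0 b≢0 (^-≢0 a≢0 N) , leading-∘ (ℕ.≤-trans (s≤s z≤n) 2≤n) M L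

-- Indexed by c, the equation for points of period c + 1, since period 0 is excluded.
FixedEquation : (ℤ → ℤ) → ℕ → ℤ → ℤ
FixedEquation F c X = iterate F X (suc c) - X

constant-fixedEquation : (∀ X → F X ≡ a) → ∀ c →
  ∃[ N ] ∃[ b ] b ≢ 0ℤ × Leading N b (FixedEquation F c)
constant-fixedEquation {F} {a} const c = 1 , -1ℤ , (λ ()) , mkLeading
  (below-cong (λ X → trans (lem a X)
    (cong (λ y → y - X - -1ℤ * (X * 1ℤ)) (sym (trans (iterate-suc F X c) (const (iterate F X c))))))
    (below-const a))
  where
  lem : ∀ a X → a ≡ a - X - -1ℤ * (X * 1ℤ)
  lem = solve-∀

-- A degree of at least two survives iteration, so subtracting `X` does not touch the leading term;
-- a constant `f` leaves `a - X`. In degree one the equation can vanish identically, as for -x and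
-- period 2.
fixedEquation-leading : ∀ f → ¬ Linear f → ∀ c →
  ∃[ N ] ∃[ a ] a ≢ 0ℤ × Leading N a (FixedEquation (evalℤ f) c)
fixedEquation-leading f ¬lin c with leadingCoeff f
... | inj₂ (1 , c≢0 , h) = contradiction (c≢0 , h) ¬lin
... | inj₂ (suc (suc n) , c≢0 , h) =
  from (leading-iterate (s≤s (s≤s z≤n)) c≢0 (leading-evalℤ f (suc (suc n)) h) c)
  where
  lem : ∀ f b y X → f - b * y + -1ℤ * (X * 1ℤ) ≡ f - X - b * y
  lem = solve-∀
  from : ∃[ N ] ∃[ b ] 2 ≤ N × b ≢ 0ℤ × Leading N b (λ X → iterate (evalℤ f) X (suc c)) →
         ∃[ N ] ∃[ a ] a ≢ 0ℤ × Leading N a (FixedEquation (evalℤ f) c)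
  from (N , b , 2≤N , b≢0 , L) = N , b , b≢0 , mkLeading
    (below-cong (λ X → lem (iterate (evalℤ f) X (suc c)) b (X ^ℤ N) X)
      (below-+ (rest L) (below-≤ 2≤N (below-scale -1ℤ (below-shift (below-const 1ℤ))))))
... | inj₂ (0 , c≢0 , h) = constant-fixedEquation
  (λ X → trans (lem (evalℤ f X) (coeff f 0)) (trans
    (cong (_+ coeff f 0) (from (leading-evalℤ f 0 h) X)) (ℤ.+-identityˡ (coeff f 0)))) c
  where
  lem : ∀ f a → f ≡ f - a * 1ℤ + a
  lem = solve-∀
  from : Leading 0 a F → ∀ X → F X - a * 1ℤ ≡ 0ℤ
  from (mkLeading (vanishing h)) = h
... | inj₁ h = constant-fixedEquation (evalℤ-zero f h) c

finitely-many-periodic : Prime p → 2 < p → ∀ f → ¬ Linear f → FinitelyMany (PeriodicPoint {p} f)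
finitely-many-periodic {p} pr 2<p f ¬lin = concat (tabulate roots) , member
  where
  Fixed : ℕ → ℤₚ p → Set
  Fixed c y = Root y (FixedEquation (evalℤ f) c)
  finite : ∀ c → FinitelyMany (Fixed c)
  finite c with N , a , a≢0 , L ← fixedEquation-leading f ¬lin c =
    finitely-many-roots pr N (<-wellFounded N) a≢0 L
  roots : Fin (p ^ 2) → List (ℤₚ p)
  roots i = proj₁ (finite (toℕ i))
  fixed : ∀ y → ((O , i , e) : PeriodicPoint f y) → ∀ c → length O ≡ suc c → Fixed c y
  fixed y (O , i , e) c q = mkRoot λ n →
    subst (λ z → + (p ^ n) ∣ℤ z - residue y n) (residue-iterate f (suc c) y n) (residue-≡ fᶜy≈y n)
    where
    fᶜy≈y : iterate (eval f) y (suc c) ≈ₚ y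
    fᶜy≈y = subst (λ l → iterate (eval f) y l ≈ₚ y) q
      (≈ₚ-trans (iterate-eval-cong f (length O) e)
        (≈ₚ-trans (subst (_≈ₚ point O i)
          (trans (sym (iterate-+ (eval f) (base O) (length O) (toℕ i)))
            (trans (cong (iterate (eval f) (base O)) (ℕ.+-comm (length O) (toℕ i)))
              (iterate-+ (eval f) (base O) (toℕ i) (length O))))
          (iterate-eval-cong f (toℕ i) (closed O))) (≈ₚ-sym e)))
  member : ∀ y → PeriodicPoint f y → Any (y ≈ₚ_) (concat (tabulate roots))
  member y P@(O , _) = go (length O) refl
    where
    go : ∀ l → length O ≡ l → Any (y ≈ₚ_) (concat (tabulate roots))
    go zero    q = contradiction (subst (1 ≤_) q (positive O)) λ ()
    go (suc c) q = concat⁺ (tabulate⁺ (fromℕ< c<p²) (subst (λ j → Any (y ≈ₚ_) (proj₁ (finite j)))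
      (sym (Fin.toℕ-fromℕ< c<p²)) (proj₂ (finite c) y (fixed y P c q))))
      where
      c<p² : c < p ^ 2
      c<p² = subst (_≤ p ^ 2) q (length-≤p² pr 2<p f O)

-- A cycle of length 9 in ℤ₃

-- Hensel's lemma for a slope of valuation exactly `e`, where the value has to vanish modulo
-- p^(2e+1). All corrections are multiples of `p ^ suc e`, so the slope modulo `p ^ suc e` never
-- changes, and the one inverse `v` serves every step, each of which gains one digit.
module Newton (D : Derivative G G₁) (e : ℕ) (X₀ w v : ℤ)
  (slope : G₁ X₀ ≡ + (p ^ e) * w ⟨mod p ^ suc e ⟩) (unit : w * v ≡ 1ℤ ⟨mod p ⟩)
  (small : + (p ^ suc e) * + (p ^ e) ∣ℤ G X₀) where

  private
    record Approximation (n : ℕ) : Set where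
      field
        value    : ℤ
        near₀    : value ≡ X₀ ⟨mod p ^ suc e ⟩
        small-at : + (p ^ (n ℕ.+ suc e)) * + (p ^ e) ∣ℤ G value

    open Approximation

    improve : ∀ {n} (X : Approximation n) →
      ∃[ Y ] value {suc n} Y ≡ value X ⟨mod p ^ (n ℕ.+ suc e) ⟩
    improve {n} record { value = X ; near₀ = X≡X₀ ; small-at = divides g GX } =
      from (mod⇒+ (≡mod-trans (derivative-≡mod′ D X≡X₀) slope)) (mod⇒+ unit) (expand D X (A * t))
      where
      A E N P t : ℤ
      A = + (p ^ (n ℕ.+ suc e))
      E = + (p ^ e)
      N = + (p ^ n)
      P = + p
      -- Solves g + w t ≡ 0 (mod p), the linear part of G (X + A t) divided by A E.
      t = - v * g
      pow : A ≡ N * (E * P)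
      pow = trans (cong +_ (ℕ.^-distribˡ-+-* p n (suc e)))
        (trans (ℤ.pos-* (p ^ n) (p ^ suc e)) (cong (λ y → N * y) (pow-suc p e)))
      X′≡X : X + A * t ≡ X ⟨mod p ^ (n ℕ.+ suc e) ⟩
      X′≡X = +⇒mod t (cong (λ y → X + y) (ℤ.*-comm A t))
      lem₁ : ∀ A E P N g s v r w →
             g * (A * E) + (E * w + s * (E * P)) * (A * (- v * g))
               + r * (A * (- v * g) * (N * (E * P) * (- v * g)))
             ≡ (g - w * v * g - P * (s * v * g - r * N * (v * g) * (v * g))) * (A * E)
      lem₁ = solve-∀
      lem₂ : ∀ A E P g τ c → (g - (1ℤ + τ * P) * g - P * c) * (A * E) ≡ (- τ * g - c) * (P * A * E)
      lem₂ = solve-∀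
      from : ∃[ s ] G₁ X ≡ E * w + s * + (p ^ suc e) → ∃[ τ ] w * v ≡ 1ℤ + τ * P →
             ∃[ r ] G (X + A * t) ≡ G X + G₁ X * (A * t) + r * (A * t * (A * t)) →
             ∃[ Y ] value {suc n} Y ≡ X ⟨mod p ^ (n ℕ.+ suc e) ⟩
      from (s , e₁) (τ , e₂) (r , e₃) = record
        { value    = X + A * t
        ; near₀    = ≡mod-trans (≡mod-∣ (pow-mono-∣ (ℕ.m≤n+m (suc e) n)) X′≡X) X≡X₀
        ; small-at = divides (- τ * g - C)
            (begin
              G (X + A * t) ≡⟨ e₃ ⟩
              G X + G₁ X * (A * t) + r * (A * t * (A * t)) ≡⟨ cong₂
                (λ y z → y + z * (A * t) + r * (A * t * (A * t))) GX
                (trans e₁ (cong (λ y → E * w + s * y) (pow-suc p e))) ⟩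
              g * (A * E) + (E * w + s * (E * P)) * (A * t) + r * (A * t * (A * t)) ≡⟨ cong
                (λ y → g * (A * E) + (E * w + s * (E * P)) * (A * t) + r * (A * t * (y * t))) pow ⟩
              g * (A * E) + (E * w + s * (E * P)) * (A * t) + r * (A * t * (N * (E * P) * t))
                ≡⟨ lem₁ A E P N g s v r w ⟩
              (g - w * v * g - P * C) * (A * E) ≡⟨ cong
                (λ y → (g - y * g - P * C) * (A * E)) e₂ ⟩
              (g - (1ℤ + τ * P) * g - P * C) * (A * E) ≡⟨ lem₂ A E P g τ C ⟩
              (- τ * g - C) * (P * A * E) ≡⟨ cong
                (λ y → (- τ * g - C) * (y * E)) (ℤ.pos-* p (p ^ (n ℕ.+ suc e))) ⟨
              (- τ * g - C) * (+ (p ^ (suc n ℕ.+ suc e)) * E) ∎)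
        } , X′≡X
        where
        open ≡-Reasoning
        C : ℤ
        C = s * v * g - r * N * (v * g) * (v * g)

    approximation : ∀ n → Approximation n
    approximation zero    = record { value = X₀ ; near₀ = ≡mod-refl ; small-at = small }
    approximation (suc n) = proj₁ (improve (approximation n))

  root : ℤₚ p
  root .residue n  = value (approximation n)
  root .coherent n =
    unmod (≡mod-∣ (pow-mono-∣ (ℕ.m≤m+n n (suc e))) (proj₂ (improve (approximation n))))

  root-Root : Root root G
  root-Root = mkRoot λ n →
    ∣-trans (∣m⇒∣m*n (+ (p ^ e)) (pow-mono-∣ (ℕ.m≤m+n n (suc e)))) (small-at (approximation n))

  root-near : ∀ n → residue root n ≡ X₀ ⟨mod p ^ suc e ⟩
  root-near n = near₀ (approximation n)

orbit-of-root : ∀ f c (y : ℤₚ p) → 1 ≤ c → Root y (λ X → iterate (evalℤ f) X c - X) →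
  ∀ n → (∀ (i j : Fin c) →
    iterate (evalℤ f) (residue y n) (toℕ i) ≡ iterate (evalℤ f) (residue y n) (toℕ j) ⟨mod p ^ n ⟩ →
    i ≡ j) →
  Σ[ O ∈ PeriodicOrbit p f ] length O ≡ c
orbit-of-root {p} f c y 1≤c h n sep = record
  { base     = y
  ; length   = c
  ; positive = 1≤c
  ; distinct = λ {i} {j} e → sep i j (≡mod-trans
      (≡mod-reflexive (sym (residue-iterate f (toℕ i) y n)))
      (≡mod-trans (mod (residue-≡ e n)) (≡mod-reflexive (residue-iterate f (toℕ j) y n))))
  ; closed   = mk≈ λ n →
      subst (λ z → + (p ^ n) ∣ℤ z - residue y n) (sym (residue-iterate f c y n)) (root-∣ h n)
  } , refl

-- Representatives below `m` keep the numbers small enough for an explicit evaluation of orbit and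
-- multiplier; `reduced-D¹` is the chain-rule product along the reduced orbit.
module Reduced (S : Smooth F) (m : ℕ) .{{_ : ℕ.NonZero m}} where

  reduced : ℤ → ℤ
  reduced X = + (F X ℤ.%ℕ m)

  reduced-D¹ : ℤ → ℕ → ℤ
  reduced-D¹ X zero    = 1ℤ
  reduced-D¹ X (suc n) = reduced-D¹ (reduced X) n * D¹ S X

  iterate-reduced : ∀ X n → iterate F X n ≡ iterate reduced X n ⟨mod m ⟩
  iterate-reduced X zero    = ≡mod-refl
  iterate-reduced X (suc n) = ≡mod-trans
    (derivative-≡mod (derivative (smooth-iterate S n)) (≡mod-sym (≡mod-%ℕ (F X) m)))
      (iterate-reduced (reduced X) n)

  D¹-reduced : ∀ X n → D¹ (smooth-iterate S n) X ≡ reduced-D¹ X n ⟨mod m ⟩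
  D¹-reduced X zero    = ≡mod-refl
  D¹-reduced X (suc n) = ≡mod-* (≡mod-trans
    (derivative-≡mod′ (derivative (smooth-iterate S n)) (≡mod-sym (≡mod-%ℕ (F X) m)))
      (D¹-reduced (reduced X) n)) ≡mod-refl

-- The single modulus m lets one orbit of representatives modulo m serve all hypotheses.
lifted-orbit : ∀ f c (X₀ w v : ℤ) e n m .{{_ : ℕ.NonZero m}} →
  let open Reduced (smooth-evalℤ f) m in
  1 ≤ c → m ≡ p ^ suc e ℕ.* p ^ e → n ≤ suc e →
  iterate reduced X₀ c ≡ X₀ ⟨mod m ⟩ →
  reduced-D¹ X₀ c - 1ℤ ≡ + (p ^ e) * w ⟨mod p ^ suc e ⟩ → w * v ≡ 1ℤ ⟨mod p ⟩ →
  (∀ (i j : Fin c) → iterate reduced X₀ (toℕ i) ≡ iterate reduced X₀ (toℕ j) ⟨mod p ^ n ⟩ → i ≡ j) →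
  Σ[ O ∈ PeriodicOrbit p f ] length O ≡ c
lifted-orbit {p} f c X₀ w v e n m 1≤c m≡ n≤ fixed slope unit sep =
  orbit-of-root f c N.root 1≤c N.root-Root n λ i j h →
    sep i j (≡mod-trans (≡mod-sym (at i)) (≡mod-trans h (at j)))
  where
  open Reduced (smooth-evalℤ f) m
  S : Smooth (evalℤ f)
  S = smooth-evalℤ f
  G′ : ℤ → ℤ
  G′ X = D¹ (smooth-iterate S c) X - 1ℤ
  DG : Derivative (λ X → iterate (evalℤ f) X c - X) G′
  DG = derivative-cong (λ X → lem (iterate (evalℤ f) X c) X) (λ X → refl)
    (derivative-+ (derivative (smooth-iterate S c)) (derivative-scale -1ℤ (derivative smooth-id)))
    where
    lem : ∀ a X → a + -1ℤ * X ≡ a - X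
    lem = solve-∀
  p^1+e∣m : + (p ^ suc e) ∣ℤ + m
  p^1+e∣m = divides (+ (p ^ e))
    (trans (cong +_ m≡) (trans (ℤ.pos-* (p ^ suc e) (p ^ e))
      (ℤ.*-comm (+ (p ^ suc e)) (+ (p ^ e)))))
  slope′ : G′ X₀ ≡ + (p ^ e) * w ⟨mod p ^ suc e ⟩
  slope′ = ≡mod-trans (≡mod-+ (≡mod-∣ p^1+e∣m (D¹-reduced X₀ c)) ≡mod-refl) slope
  small : + (p ^ suc e) * + (p ^ e) ∣ℤ iterate (evalℤ f) X₀ c - X₀
  small = subst (_∣ℤ iterate (evalℤ f) X₀ c - X₀) (trans (cong +_ m≡) (ℤ.pos-* (p ^ suc e) (p ^ e)))
    (unmod (≡mod-trans (iterate-reduced X₀ c) fixed))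
  module N = Newton DG e X₀ w v slope′ unit small
  at : ∀ (i : Fin c) → iterate (evalℤ f) (residue N.root n) (toℕ i)
                         ≡ iterate reduced X₀ (toℕ i) ⟨mod p ^ n ⟩
  at i = ≡mod-∣ (pow-mono-∣ n≤)
    (≡mod-trans (derivative-≡mod (derivative (smooth-iterate S (toℕ i))) (N.root-near n))
    (≡mod-∣ p^1+e∣m (iterate-reduced X₀ (toℕ i))))

-- As a function modulo 3 this is x - 1, a single 3-cycle, and its derivatives at 0, 1, 2 are 1, 2,
-- 2 with product 1 modulo 3: the one case that leaves room for length 9. Modulo 9 it permutes all
-- nine classes in a single cycle.
f₉ : ℤ[x]
f₉ = - + 4 ∷ + 1 ∷ + 0 ∷ - + 2 ∷ + 0 ∷ - + 1 ∷ []

nine-cycle : Σ[ f ∈ ℤ[x] ] Σ[ O ∈ PeriodicOrbit 3 f ] length O ≡ 9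
-- The derivative of f⁹(x) - x at 14 is -27 modulo 81, so `e = 3`, and -1 is its own inverse. Hence
-- f⁹(14) ≡ 14 is required modulo 2187 = 3^(2·3+1). The nine points are already distinct modulo 3².
nine-cycle = f₉ , lifted-orbit f₉ 9 (+ 14) -1ℤ -1ℤ 3 2 2187 (s≤s z≤n) refl (s≤s (s≤s z≤n))
  ≡mod-refl slope ≡mod-refl separated
  where
  open Reduced (smooth-evalℤ f₉) 2187
  slope : reduced-D¹ (+ 14) 9 - 1ℤ ≡ + 27 * -1ℤ ⟨mod 81 ⟩
  slope = from-yes (≡mod? (reduced-D¹ (+ 14) 9 - 1ℤ) (+ 27 * -1ℤ) 81)
  separated : ∀ (i j : Fin 9) →
    iterate reduced (+ 14) (toℕ i) ≡ iterate reduced (+ 14) (toℕ j) ⟨mod 9 ⟩ → i ≡ j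
  separated = from-yes (Fin.all? {n = 9} λ i → Fin.all? {n = 9} λ j →
    ≡mod? (iterate reduced (+ 14) (toℕ i)) (iterate reduced (+ 14) (toℕ j)) 9 →-dec (i Fin.≟ j))

mainTheorem9 : ((p : ℕ) → Prime p → ¬ (2 ∣ p) → (f : ℤ[x]) →
    ((O : PeriodicOrbit p f) →
    length O ≤ p ^ 2
    × (3 < p → ProductOf≤And∣ p (p ∸ 1) (length O))
    × (p ≡ 3 → ProductOf≤And∣ 3 2 (length O) ⊎ length O ≡ 9))
    × (¬ Linear f → FinitelyMany (PeriodicPoint {p} f)))
    × (Σ[ f ∈ ℤ[x] ] Σ[ O ∈ PeriodicOrbit 3 f ] length O ≡ 9)
mainTheorem9 = lengths-and-finiteness , nine-cycle
  where
  lengths-and-finiteness : (p : ℕ) → Prime p → ¬ (2 ∣ p) → (f : ℤ[x]) →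
    ((O : PeriodicOrbit p f) →
    length O ≤ p ^ 2
    × (3 < p → ProductOf≤And∣ p (p ∸ 1) (length O))
    × (p ≡ 3 → ProductOf≤And∣ 3 2 (length O) ⊎ length O ≡ 9))
    × (¬ Linear f → FinitelyMany (PeriodicPoint {p} f))
  lengths-and-finiteness p pr 2∤p f =
    (λ O → length-≤p² pr 2<p f O , (λ 3<p → length-p>3 pr 3<p f O) ,
      λ { refl → length-p≡3 pr f O }) ,
    finitely-many-periodic pr 2<p f
    where
    2<p : 2 < p
    2<p = prime-odd⇒2< pr 2∤p
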